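{- Let $G$ be a connected graph of order $n$. If $\sigma_2(G)\ge n-k+1$ for some positive integer $k$, then $G$ has a spanning tree $T$ with at most $k-|B(T)|+1$ end vertices, where $B(T)$ is the set of branch vertices of $T$.
   Context: All graphs are finite, undirected, without loops or multiple edges. For a graph $G$, $\sigma_2(G)$ denotes the minimum of $d_G(u)+d_G(v)$ over all pairs of distinct nonadjacent vertices $u,v$ of $G$; if $G$ has no two nonadjacent vertices (i.e. $G$ is complete), $\sigma_2(G)=+\infty$. An end vertex of a tree is a vertex of degree one in the tree. A branch vertex of a tree $T$ is a vertex of degree at least three in $T$; $B(T)$ denotes the set of branch vertices of $T$. -}

module Defs where

open import Data.Nat using (ℕ; suc; _≤_; _+_)
open import Data.Fin using (Fin) renaming (zero to fzero; suc to fsuc)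
open import Data.Bool using (Bool; true; false; if_then_else_)
open import Data.List using (List; []; _∷_; length)
open import Data.List.Relation.Unary.Unique.Propositional using (Unique)
open import Data.Product using (Σ; _×_; ∃-syntax)
open import Relation.Binary.PropositionalEquality using (_≡_; _≢_)
open import Relation.Nullary using (¬_)
open import Relation.Nullary.Decidable using (does)
open import Data.Nat using (_≟_; _≤?_)
open import Data.Integer using (ℤ; +_) renaming (_≤_ to _≤ℤ_)

record Graph (n : ℕ) : Set where
  field
    adj   : Fin n → Fin n → Bool
    sym   : ∀ u v → adj u v ≡ adj v u
    irrefl : ∀ v → adj v v ≡ false
open Graph public

count : ∀ {n} → (Fin n → Bool) → ℕ
count {ℕ.zero} p = 0
count {suc n} p = (if p fzero then 1 else 0) + count {n} (λ i → p (fsuc i))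

degree : ∀ {n} → Graph n → Fin n → ℕ
degree G v = count (adj G v)

Adjacent : ∀ {n} → Graph n → Fin n → Fin n → Set
Adjacent G u v = adj G u v ≡ true

data Walk {n} (G : Graph n) : Fin n → Fin n → List (Fin n) → Set where
  here  : ∀ v → Walk G v v (v ∷ [])
  step  : ∀ {u w v vs} → Adjacent G u w → Walk G w v vs → Walk G u v (u ∷ vs)

Connected : ∀ {n} → Graph n → Set
Connected G = ∀ u v → ∃[ vs ] Walk G u v vs

HasCycle : ∀ {n} → Graph n → Set
HasCycle {n} G = ∃[ u ] ∃[ v ] ∃[ vs ]
  (Walk G u v vs × Unique vs × 3 ≤ length vs × Adjacent G v u)

IsTree : ∀ {n} → Graph n → Set
IsTree G = Connected G × ¬ HasCycle G

Subgraph : ∀ {n} → Graph n → Graph n → Set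
Subgraph T G = ∀ u v → Adjacent T u v → Adjacent G u v

IsSpanningTree : ∀ {n} → Graph n → Graph n → Set
IsSpanningTree T G = Subgraph T G × IsTree T

numEnd : ∀ {n} → Graph n → ℕ
numEnd T = count (λ v → does (degree T v ≟ 1))

numBranch : ∀ {n} → Graph n → ℕ
numBranch T = count (λ v → does (3 ≤? degree T v))

-- σ₂(G) ≥ m : every pair of distinct nonadjacent vertices has degree sum ≥ m
-- (vacuous for complete graphs, matching σ₂ = +∞)
σ₂≥ : ∀ {n} → Graph n → ℤ → Set
σ₂≥ G m = ∀ u v → u ≢ v → ¬ Adjacent G u v → m ≤ℤ + (degree G u + degree G v)

{-# OPTIONS --safe #-}
module Submission where

-- Call the number of end vertices plus the number of branch vertices of T its cost, and take a spanning tree T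
-- of least cost, with a branch vertex (otherwise T is a path).  For an end u, root T at u.  If u is adjacent in G
-- to a vertex w that is not its T-neighbour, exchanging w–par(w) for uw shows that par(w) has degree 2 in T.  So
-- w ↦ par(w) maps N(u) injectively into {u} ∪ D, where D is the set of vertices of degree 2 in T.
-- Let x be another end and b the branch vertex nearest to x.  If x were adjacent to an end y, or to some
-- s = par(w) ∈ D with w ∈ N(u) (which becomes an end after the exchange above), then adding that edge and deleting
-- an edge at a branch vertex would lower the cost.  If x is adjacent to a branch vertex y ≠ b, the leg of x moves
-- from b to y; for b outermost as seen from u this can be iterated until b stops being a branch vertex, which
-- lowers the cost.  Otherwise N(x) ⊆ {b} ∪ D is disjoint from par(N(u)), hence d(u) + d(x) ≤ |D| + 2.
-- As cost(T) + |D| ≤ n, the degree condition gives cost(T) ≤ k + 1.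

open import Defs
open import Data.Bool using (Bool; true; false; if_then_else_; _∧_; _∨_; not)
import Data.Bool.Properties as B
open import Data.Empty using (⊥; ⊥-elim)
open import Data.Fin using (Fin) renaming (zero to fzero; suc to fsuc)
open import Data.Fin.Properties using (any?) renaming (_≟_ to _≟ᶠ_)
open import Data.List using (List; length)
open import Data.List.Relation.Unary.All using (All; _∷_)
open import Data.List.Relation.Unary.AllPairs using (_∷_)
open import Data.List.Relation.Unary.Unique.Propositional using (Unique)
open import Data.Nat using (ℕ; zero; suc; _≤_; _<_; _+_; _*_; z≤n; s≤s; _≟_; _≤?_)
open import Data.Nat.Properties
open import Data.Product using (_×_; _,_; proj₁; proj₂; ∃; ∃-syntax)
open import Data.Sum using (_⊎_; inj₁; inj₂)
open import Function using (_∘_; case_of_)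
open import Function.Bundles using (mk⇔)
open import Relation.Binary.Construct.Closure.ReflexiveTransitive using (Star; ε; _◅_; _◅◅_; reverse; kleisliStar)
import Relation.Binary.Construct.Closure.ReflexiveTransitive as Star
open import Relation.Binary.PropositionalEquality as ≡ using (_≡_; _≢_; refl; trans; cong; cong₂; subst)
open import Relation.Nullary using (¬_; Dec; yes; no; contradiction)
open import Relation.Nullary.Decidable using (does; dec-true; dec-false; does-⇔; _×-dec_; _⊎-dec_; ¬?)
open import Algebra.Properties.CommutativeMonoid.Sum +-0-commutativeMonoid
  using (sum; sum-cong-≗; ∑-distrib-+; ∑-comm; sum-replicate-zero)
open ≤-Reasoning

private variable
  n : ℕ

-- Sums of indicator functions over `Fin n`.

⟦_⟧ : Bool → ℕ
⟦ b ⟧ = if b then 1 else 0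

⟦⟧-≤ : ∀ b {m} → (b ≡ true → 1 ≤ m) → ⟦ b ⟧ ≤ m
⟦⟧-≤ true  h = h refl
⟦⟧-≤ false h = z≤n

⟦yes⟧ : ∀ {A : Set} (a? : Dec A) → A → ⟦ does a? ⟧ ≡ 1
⟦yes⟧ a? a = cong ⟦_⟧ (dec-true a? a)

⟦no⟧ : ∀ {A : Set} (a? : Dec A) → ¬ A → ⟦ does a? ⟧ ≡ 0
⟦no⟧ a? ¬a = cong ⟦_⟧ (dec-false a? ¬a)

⟦∧not⟧ : ∀ a b → (b ≡ true → a ≡ true) → ⟦ a ⟧ ≡ ⟦ a ∧ not b ⟧ + ⟦ b ⟧
⟦∧not⟧ true  true  h = refl
⟦∧not⟧ true  false h = refl
⟦∧not⟧ false true  h with () ← h refl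
⟦∧not⟧ false false h = refl

⟦∨⟧ : ∀ a b → (b ≡ true → a ≡ false) → ⟦ a ∨ b ⟧ ≡ ⟦ a ⟧ + ⟦ b ⟧
⟦∨⟧ true  true  h with () ← h refl
⟦∨⟧ true  false h = refl
⟦∨⟧ false b     h = refl

does-true : ∀ {A : Set} (a? : Dec A) → does a? ≡ true → A
does-true (yes a) _ = a

δ : Fin n → Fin n → ℕ
δ v x = ⟦ does (v ≟ᶠ x) ⟧

δ-refl : (v : Fin n) → δ v v ≡ 1
δ-refl v = ⟦yes⟧ (v ≟ᶠ v) refl

δ-≢ : {v x : Fin n} → v ≢ x → δ v x ≡ 0
δ-≢ {v = v} {x} = ⟦no⟧ (v ≟ᶠ x)

count≡sum : (p : Fin n → Bool) → count p ≡ sum (⟦_⟧ ∘ p)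
count≡sum {zero}  p = refl
count≡sum {suc n} p = cong (⟦ p fzero ⟧ +_) (count≡sum (p ∘ fsuc))

sum-mono-≤ : {f g : Fin n → ℕ} → (∀ i → f i ≤ g i) → sum f ≤ sum g
sum-mono-≤ {zero}  h = z≤n
sum-mono-≤ {suc n} h = +-mono-≤ (h fzero) (sum-mono-≤ (h ∘ fsuc))

sum-zero : {f : Fin n → ℕ} → (∀ i → f i ≡ 0) → sum f ≡ 0
sum-zero {n} h = trans (sum-cong-≗ h) (sum-replicate-zero n)

sum-one : ∀ n → sum {n} (λ _ → 1) ≡ n
sum-one zero    = refl
sum-one (suc n) = cong suc (sum-one n)

sum-δ : (x : Fin n) → sum (λ v → δ v x) ≡ 1
sum-δ {suc n} fzero    = cong suc (sum-zero {n} {λ v → δ (fsuc v) fzero} (λ _ → refl))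
sum-δ {suc n} (fsuc x) = sum-δ x

sum-δ′ : (x : Fin n) → sum (λ v → δ x v) ≡ 1
sum-δ′ x = trans (sum-cong-≗ λ v → cong ⟦_⟧ (does-⇔ (mk⇔ ≡.sym ≡.sym) (x ≟ᶠ v) (v ≟ᶠ x))) (sum-δ x)

sum-+δ : (f : Fin n → ℕ) (x : Fin n) → sum (λ v → f v + δ v x) ≡ sum f + 1
sum-+δ f x = trans (∑-distrib-+ f (λ v → δ v x)) (cong (sum f +_) (sum-δ x))

sum-+2δ : (f : Fin n → ℕ) (x y : Fin n) → sum (λ v → f v + (δ v x + δ v y)) ≡ sum f + 2
sum-+2δ f x y = trans (∑-distrib-+ f _)
  (cong (sum f +_) (trans (∑-distrib-+ (λ v → δ v x) _) (cong₂ _+_ (sum-δ x) (sum-δ y))))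

sum≤1 : {p : Fin n → Bool} → (∀ i j → p i ≡ true → p j ≡ true → i ≡ j) → sum (⟦_⟧ ∘ p) ≤ 1
sum≤1 {p = p} unique with any? (λ i → p i B.≟ true)
... | yes (i , pi) = begin
  sum (⟦_⟧ ∘ p)        ≤⟨ sum-mono-≤ (λ j → ⟦⟧-≤ (p j) λ pj → ≤-reflexive (≡.sym (⟦yes⟧ (j ≟ᶠ i) (unique j i pj pi)))) ⟩
  sum (λ j → δ j i)    ≡⟨ sum-δ i ⟩
  1                    ∎
... | no none = ≤-trans (≤-reflexive (sum-zero λ j → cong ⟦_⟧ (B.¬-not λ pj → none (j , pj)))) z≤n

-- Degrees and neighbours.

degree≡sum : (T : Graph n) (v : Fin n) → degree T v ≡ sum (λ w → ⟦ adj T v w ⟧)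
degree≡sum T v = count≡sum (adj T v)

Adj-sym : (T : Graph n) {v w : Fin n} → Adjacent T v w → Adjacent T w v
Adj-sym T {v} {w} = trans (sym T w v)

Adj⇒≢ : (T : Graph n) {v w : Fin n} → Adjacent T v w → v ≢ w
Adj⇒≢ T {v} vw refl with () ← trans (≡.sym vw) (irrefl T v)

adj? : (T : Graph n) (v w : Fin n) → Dec (Adjacent T v w)
adj? T v w = adj T v w B.≟ true

private
  δ≤adj : (T : Graph n) {v a : Fin n} → Adjacent T v a → (w : Fin n) → δ w a ≤ ⟦ adj T v w ⟧
  δ≤adj T {v} {a} va w = ⟦⟧-≤ (does (w ≟ᶠ a)) λ e →
    ≤-reflexive (≡.sym (cong ⟦_⟧ (subst (Adjacent T v) (≡.sym (does-true (w ≟ᶠ a) e)) va)))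

neighbour⇒1≤degree : (T : Graph n) {v a : Fin n} → Adjacent T v a → 1 ≤ degree T v
neighbour⇒1≤degree T {v} {a} va = begin
  1                             ≡⟨ sum-δ a ⟨
  sum (λ w → δ w a)             ≤⟨ sum-mono-≤ (δ≤adj T va) ⟩
  sum (λ w → ⟦ adj T v w ⟧)     ≡⟨ degree≡sum T v ⟨
  degree T v                    ∎

neighbours⇒2≤degree : (T : Graph n) {v a b : Fin n} → a ≢ b →
                      Adjacent T v a → Adjacent T v b → 2 ≤ degree T v
neighbours⇒2≤degree T {v} {a} {b} a≢b va vb = begin
  2                               ≡⟨ cong (_+ 1) (sum-δ a) ⟨
  sum (λ w → δ w a) + 1           ≡⟨ sum-+δ _ b ⟨
  sum (λ w → δ w a + δ w b)       ≤⟨ sum-mono-≤ pointwise ⟩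
  sum (λ w → ⟦ adj T v w ⟧)       ≡⟨ degree≡sum T v ⟨
  degree T v                      ∎
  where
  pointwise : ∀ w → δ w a + δ w b ≤ ⟦ adj T v w ⟧
  pointwise w with w ≟ᶠ a
  ... | yes refl rewrite δ-≢ a≢b = ≤-reflexive (≡.sym (cong ⟦_⟧ va))
  ... | no  _    = δ≤adj T vb w

neighbours⇒3≤degree : (T : Graph n) {v a b c : Fin n} → a ≢ b → a ≢ c → b ≢ c →
                      Adjacent T v a → Adjacent T v b → Adjacent T v c → 3 ≤ degree T v
neighbours⇒3≤degree T {v} {a} {b} {c} a≢b a≢c b≢c va vb vc = begin
  3                                       ≡⟨ cong (_+ 2) (sum-δ a) ⟨
  sum (λ w → δ w a) + 2                   ≡⟨ sum-+2δ _ b c ⟨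
  sum (λ w → δ w a + (δ w b + δ w c))     ≤⟨ sum-mono-≤ pointwise ⟩
  sum (λ w → ⟦ adj T v w ⟧)               ≡⟨ degree≡sum T v ⟨
  degree T v                              ∎
  where
  pointwise : ∀ w → δ w a + (δ w b + δ w c) ≤ ⟦ adj T v w ⟧
  pointwise w with w ≟ᶠ a
  ... | yes refl rewrite δ-≢ a≢b | δ-≢ a≢c = ≤-reflexive (≡.sym (cong ⟦_⟧ va))
  ... | no  _ with w ≟ᶠ b
  ...   | yes refl rewrite δ-≢ b≢c = ≤-reflexive (≡.sym (cong ⟦_⟧ vb))
  ...   | no  _    = δ≤adj T vc w

singleNeighbour⇒degree≤1 : (T : Graph n) {v : Fin n} (a : Fin n) →
                           (∀ w → Adjacent T v w → w ≡ a) → degree T v ≤ 1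
singleNeighbour⇒degree≤1 T {v} a only = begin
  degree T v                    ≡⟨ degree≡sum T v ⟩
  sum (λ w → ⟦ adj T v w ⟧)     ≤⟨ sum-mono-≤ (λ w → ⟦⟧-≤ _ λ vw → ≤-reflexive (≡.sym (⟦yes⟧ (w ≟ᶠ a) (only w vw)))) ⟩
  sum (λ w → δ w a)             ≡⟨ sum-δ a ⟩
  1                             ∎

secondNeighbour : (T : Graph n) {v : Fin n} (a : Fin n) → 2 ≤ degree T v →
                  ∃[ w ] (Adjacent T v w × w ≢ a)
secondNeighbour T {v} a 2≤d with any? (λ w → adj? T v w ×-dec ¬? (w ≟ᶠ a))
... | yes found = found
... | no  none  = contradiction (singleNeighbour⇒degree≤1 T a only) (<⇒≱ 2≤d)
  where
  only : ∀ w → Adjacent T v w → w ≡ a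
  only w vw with w ≟ᶠ a
  ... | yes e = e
  ... | no ne = contradiction (w , vw , ne) none

-- Edge insertion and deletion

IsEdge : Fin n → Fin n → Fin n → Fin n → Set
IsEdge c d v w = (v ≡ c × w ≡ d) ⊎ (v ≡ d × w ≡ c)

isEdge? : (c d v w : Fin n) → Dec (IsEdge c d v w)
isEdge? c d v w = ((v ≟ᶠ c) ×-dec (w ≟ᶠ d)) ⊎-dec ((v ≟ᶠ d) ×-dec (w ≟ᶠ c))

IsEdge-swap : {c d v w : Fin n} → IsEdge c d v w → IsEdge c d w v
IsEdge-swap (inj₁ (p , q)) = inj₂ (q , p)
IsEdge-swap (inj₂ (p , q)) = inj₁ (q , p)

isEdge?-sym : (c d v w : Fin n) → does (isEdge? c d v w) ≡ does (isEdge? c d w v)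
isEdge?-sym c d v w = does-⇔ (mk⇔ IsEdge-swap IsEdge-swap) (isEdge? c d v w) (isEdge? c d w v)

remove : Graph n → Fin n → Fin n → Graph n
remove T c d = record
  { adj    = λ v w → adj T v w ∧ not (does (isEdge? c d v w))
  ; sym    = λ v w → cong₂ (λ p q → p ∧ not q) (sym T v w) (isEdge?-sym c d v w)
  ; irrefl = λ v → cong (_∧ not (does (isEdge? c d v v))) (irrefl T v)
  }

insert : Graph n → (x y : Fin n) → x ≢ y → Graph n
insert T x y x≢y = record
  { adj    = λ v w → adj T v w ∨ does (isEdge? x y v w)
  ; sym    = λ v w → cong₂ _∨_ (sym T v w) (isEdge?-sym x y v w)
  ; irrefl = λ v → cong₂ _∨_ (irrefl T v) (dec-false (isEdge? x y v v) noLoop)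
  }
  where
  noLoop : ∀ {v} → ¬ IsEdge x y v v
  noLoop (inj₁ (p , q)) = x≢y (trans (≡.sym p) q)
  noLoop (inj₂ (p , q)) = x≢y (trans (≡.sym q) p)

remove-keeps : (T : Graph n) {c d v w : Fin n} → Adjacent T v w → ¬ IsEdge c d v w → Adjacent (remove T c d) v w
remove-keeps T {c} {d} {v} {w} vw ¬e = cong₂ (λ p q → p ∧ not q) vw (dec-false (isEdge? c d v w) ¬e)

remove-⊆ : (T : Graph n) {c d : Fin n} → Subgraph (remove T c d) T
remove-⊆ T v w e with adj T v w
... | true = refl

insert-keeps : (T : Graph n) {x y v w : Fin n} {x≢y : x ≢ y} → Adjacent T v w → Adjacent (insert T x y x≢y) v w
insert-keeps T vw = cong (_∨ _) vw

insert-new : (T : Graph n) {x y : Fin n} {x≢y : x ≢ y} → Adjacent (insert T x y x≢y) x y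
insert-new T {x} {y} = trans (cong (adj T x y ∨_) (dec-true (isEdge? x y x y) (inj₁ (refl , refl)))) (B.∨-zeroʳ _)

insert-cases : (T : Graph n) {x y v w : Fin n} {x≢y : x ≢ y} → Adjacent (insert T x y x≢y) v w →
               Adjacent T v w ⊎ IsEdge x y v w
insert-cases T {x} {y} {v} {w} e with adj T v w
... | true  = inj₁ refl
... | false = inj₂ (does-true (isEdge? x y v w) e)

insert-⊆ : (T G : Graph n) {x y : Fin n} {x≢y : x ≢ y} → Subgraph T G → Adjacent G x y → Subgraph (insert T x y x≢y) G
insert-⊆ T G {x≢y = x≢y} T⊆G xy v w e with insert-cases T {x≢y = x≢y} e
... | inj₁ vw                = T⊆G v w vw
... | inj₂ (inj₁ (refl , refl)) = xy
... | inj₂ (inj₂ (refl , refl)) = Adj-sym G xy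

sum-isEdge : {c d : Fin n} → c ≢ d → (v : Fin n) → sum (λ w → ⟦ does (isEdge? c d v w) ⟧) ≡ δ v c + δ v d
sum-isEdge {n} {c} {d} c≢d v with v ≟ᶠ c | v ≟ᶠ d
... | yes refl | yes refl = contradiction refl c≢d
... | yes refl | no _     = trans (sum-cong-≗ λ w → cong ⟦_⟧ (B.∨-identityʳ (does (w ≟ᶠ d)))) (sum-δ d)
... | no _     | yes refl = sum-δ c
... | no _     | no _     = sum-replicate-zero n

-- `δ v c + δ v d` is the degree of `v` in the single edge `cd`. The additive form avoids truncated
-- subtraction, so deletions and insertions can later be cancelled against each other.
degree-remove : (T : Graph n) {c d : Fin n} → Adjacent T c d → (v : Fin n) →
                degree T v ≡ degree (remove T c d) v + (δ v c + δ v d)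
degree-remove T {c} {d} cd v = begin-equality
  degree T v                                             ≡⟨ degree≡sum T v ⟩
  sum (λ w → ⟦ adj T v w ⟧)                              ≡⟨ sum-cong-≗ pointwise ⟩
  sum (λ w → ⟦ adj (remove T c d) v w ⟧ + ⟦ does (isEdge? c d v w) ⟧)
    ≡⟨ ∑-distrib-+ (λ w → ⟦ adj (remove T c d) v w ⟧) _ ⟩
  sum (λ w → ⟦ adj (remove T c d) v w ⟧) + sum (λ w → ⟦ does (isEdge? c d v w) ⟧)
    ≡⟨ cong₂ _+_ (≡.sym (degree≡sum (remove T c d) v)) (sum-isEdge (Adj⇒≢ T cd) v) ⟩
  degree (remove T c d) v + (δ v c + δ v d)              ∎
  where
  pointwise : ∀ w → ⟦ adj T v w ⟧ ≡ ⟦ adj (remove T c d) v w ⟧ + ⟦ does (isEdge? c d v w) ⟧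
  pointwise w = ⟦∧not⟧ (adj T v w) _ (edge ∘ does-true (isEdge? c d v w))
    where
    edge : IsEdge c d v w → Adjacent T v w
    edge (inj₁ (refl , refl)) = cd
    edge (inj₂ (refl , refl)) = Adj-sym T cd

degree-insert : (T : Graph n) {x y : Fin n} (x≢y : x ≢ y) → ¬ Adjacent T x y → (v : Fin n) →
                degree (insert T x y x≢y) v ≡ degree T v + (δ v x + δ v y)
degree-insert T {x} {y} x≢y ¬xy v = begin-equality
  degree T′ v                                            ≡⟨ degree≡sum T′ v ⟩
  sum (λ w → ⟦ adj T′ v w ⟧)                             ≡⟨ sum-cong-≗ pointwise ⟩
  sum (λ w → ⟦ adj T v w ⟧ + ⟦ does (isEdge? x y v w) ⟧) ≡⟨ ∑-distrib-+ (λ w → ⟦ adj T v w ⟧) _ ⟩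
  sum (λ w → ⟦ adj T v w ⟧) + sum (λ w → ⟦ does (isEdge? x y v w) ⟧)
    ≡⟨ cong₂ _+_ (≡.sym (degree≡sum T v)) (sum-isEdge x≢y v) ⟩
  degree T v + (δ v x + δ v y)                           ∎
  where
  T′ = insert T x y x≢y
  pointwise : ∀ w → ⟦ adj T′ v w ⟧ ≡ ⟦ adj T v w ⟧ + ⟦ does (isEdge? x y v w) ⟧
  pointwise w = ⟦∨⟧ (adj T v w) _ (B.¬-not ∘ edge ∘ does-true (isEdge? x y v w))
    where
    edge : IsEdge x y v w → ¬ Adjacent T v w
    edge (inj₁ (refl , refl)) = ¬xy
    edge (inj₂ (refl , refl)) = ¬xy ∘ Adj-sym T

-- Connectivity as reachability.

Conn : Graph n → Set
Conn T = ∀ u v → Star (Adjacent T) u v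

walk⇒star : {T : Graph n} {u v : Fin n} {vs : List (Fin n)} → Walk T u v vs → Star (Adjacent T) u v
walk⇒star (here _)    = ε
walk⇒star (step uw W) = uw ◅ walk⇒star W

star⇒walk : {T : Graph n} {u v : Fin n} → Star (Adjacent T) u v → ∃[ vs ] Walk T u v vs
star⇒walk ε        = _ , here _
star⇒walk (uw ◅ s) = _ , step uw (proj₂ (star⇒walk s))

star-sym : (T : Graph n) {u v : Fin n} → Star (Adjacent T) u v → Star (Adjacent T) v u
star-sym T = reverse (Adj-sym T)

conn-reroute : (T T′ : Graph n) → Conn T → (∀ {v w} → Adjacent T v w → Star (Adjacent T′) v w) → Conn T′
conn-reroute T T′ conn h u v = kleisliStar (λ z → z) h (conn u v)

conn-remove : (T : Graph n) {c d : Fin n} → Conn T → Star (Adjacent (remove T c d)) c d → Conn (remove T c d)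
conn-remove T {c} {d} conn cd = conn-reroute T (remove T c d) conn edge
  where
  edge : ∀ {v w} → Adjacent T v w → Star (Adjacent (remove T c d)) v w
  edge {v} {w} vw with isEdge? c d v w
  ... | yes (inj₁ (refl , refl)) = cd
  ... | yes (inj₂ (refl , refl)) = star-sym (remove T c d) cd
  ... | no ¬e = remove-keeps T vw ¬e ◅ ε

-- Extremal choices.

least : {P : ℕ → Set} → (∀ k → Dec (P k)) → ∀ k → P k → ∃[ m ] (P m × (∀ j → P j → m ≤ j))
least P? k pk with P? 0
... | yes p0 = 0 , p0 , λ _ _ → z≤n
least P? zero    pk | no ¬p0 = contradiction pk ¬p0
least P? (suc k) pk | no ¬p0 with least (P? ∘ suc) k pk
... | m , pm , min = suc m , pm , λ where
  zero    p → contradiction p ¬p0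
  (suc j) p → s≤s (min j p)

argmax : {P : Fin n → Set} → (∀ v → Dec (P v)) → (ρ : Fin n → ℕ) → ∃ P → ∃[ v ] (P v × (∀ w → P w → ρ w ≤ ρ v))
argmax {zero}  P? ρ (() , _)
argmax {suc n} {P} P? ρ nonempty with any? (P? ∘ fsuc)
... | no none = fzero , p0 nonempty , λ where
    fzero    _ → ≤-refl
    (fsuc i) p → contradiction (i , p) none
  where
  p0 : ∃ P → P fzero
  p0 (fzero  , p) = p
  p0 (fsuc i , p) = contradiction (i , p) none
... | yes some with argmax (P? ∘ fsuc) (ρ ∘ fsuc) some | P? fzero
...   | i , pi , max | no ¬p0 = fsuc i , pi , λ where
    fzero    p → contradiction p ¬p0
    (fsuc j) p → max j p
...   | i , pi , max | yes p0 with ≤-total (ρ fzero) (ρ (fsuc i))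
...     | inj₁ le = fsuc i , pi , λ where
    fzero    p → le
    (fsuc j) p → max j p
...     | inj₂ ge = fzero , p0 , λ where
    fzero    p → ≤-refl
    (fsuc j) p → ≤-trans (max j p) ge

argmin : {P : Fin n → Set} → (∀ v → Dec (P v)) → (ρ : Fin n → ℕ) → ∃ P → ∃[ v ] (P v × (∀ w → P w → ρ v ≤ ρ w))
argmin {n} {P} P? ρ (v₀ , p₀) with least (λ k → any? (λ v → P? v ×-dec (ρ v ≟ k))) (ρ v₀) (v₀ , p₀ , refl)
... | _ , (v , pv , refl) , min = v , pv , λ w pw → min (ρ w) (w , pw , refl)

-- Breadth-first rooting

-- `ρ` is the distance to `r` and `par` picks a neighbour one step closer, left unspecified at the
-- root. Any connected graph has such a rooting, so it can be used before the graph is known to be a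
-- tree.
record Rooted (T : Graph n) (r : Fin n) : Set where
  field
    ρ       : Fin n → ℕ
    par     : Fin n → Fin n
    ρ-root  : ρ r ≡ 0
    ρ≡0     : ∀ v → ρ v ≡ 0 → v ≡ r
    par-adj : ∀ v → v ≢ r → Adjacent T v (par v)
    par-ρ   : ∀ v → v ≢ r → ρ v ≡ suc (ρ (par v))
    ρ-lip   : ∀ {v w} → Adjacent T v w → ρ w ≤ suc (ρ v)

module _ (T : Graph n) (conn : Conn T) (r : Fin n) where
  private
    Dist : ℕ → Fin n → Set
    Dist zero    v = v ≡ r
    Dist (suc k) v = ∃[ w ] (Adjacent T v w × Dist k w)

    dist? : ∀ k v → Dec (Dist k v)
    dist? zero    v = v ≟ᶠ r
    dist? (suc k) v = any? (λ w → adj? T v w ×-dec dist? k w)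

    star⇒dist : ∀ {v} → Star (Adjacent T) v r → ∃[ k ] Dist k v
    star⇒dist ε        = 0 , refl
    star⇒dist (vw ◅ s) with star⇒dist s
    ... | k , d = suc k , _ , vw , d

    shortest : ∀ v → ∃[ m ] (Dist m v × (∀ j → Dist j v → m ≤ j))
    shortest v with star⇒dist (conn v r)
    ... | k , d = least (λ j → dist? j v) k d

    ρ : Fin n → ℕ
    ρ v = proj₁ (shortest v)

    ρ-lip : ∀ {v w} → Adjacent T v w → ρ w ≤ suc (ρ v)
    ρ-lip {v} {w} vw = proj₂ (proj₂ (shortest w)) _ (v , Adj-sym T vw , proj₁ (proj₂ (shortest v)))

    parent : ∀ v → v ≢ r → ∃[ w ] (Adjacent T v w × ρ v ≡ suc (ρ w))
    parent v v≢r with shortest v in eq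
    ... | zero  , d , _ = contradiction d v≢r
    -- By `ρ-lip` the first step of a shortest walk gains at most one level; the remaining `k` steps
    -- show that it gains at least one.
    ... | suc k , (w , vw , d) , _ = w , vw , ≤-antisym
      (≤-trans (≤-reflexive (≡.sym (cong proj₁ eq))) (ρ-lip (Adj-sym T vw)))
      (s≤s (proj₂ (proj₂ (shortest w)) k d))

    parentOr : ∀ v → Dec (v ≡ r) → Fin n
    parentOr v (yes _)  = v
    parentOr v (no v≢r) = proj₁ (parent v v≢r)

    par : Fin n → Fin n
    par v = parentOr v (v ≟ᶠ r)

    par-spec : ∀ v → v ≢ r → Adjacent T v (par v) × ρ v ≡ suc (ρ (par v))
    par-spec v v≢r = spec (v ≟ᶠ r)
      where
      spec : (d : Dec (v ≡ r)) → Adjacent T v (parentOr v d) × ρ v ≡ suc (ρ (parentOr v d))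
      spec (yes e) = contradiction e v≢r
      spec (no ne) = proj₂ (parent v ne)

  abstract
    rooted : Rooted T r
    rooted = record
      { ρ = ρ
      ; par = par
      ; ρ-root = n≤0⇒n≡0 (proj₂ (proj₂ (shortest r)) 0 refl)
      ; ρ≡0 = λ v e → subst (λ k → Dist k v) e (proj₁ (proj₂ (shortest v)))
      ; par-adj = λ v ne → proj₁ (par-spec v ne)
      ; par-ρ = λ v ne → proj₂ (par-spec v ne)
      ; ρ-lip = ρ-lip
      }

module RootedProperties {T : Graph n} {r : Fin n} (R : Rooted T r) where
  open Rooted R public

  data Anc (a : Fin n) : Fin n → Set where
    base : Anc a a
    up   : ∀ {v} → v ≢ r → Anc a (par v) → Anc a v

  par-< : ∀ v → v ≢ r → ρ (par v) < ρ v
  par-< v v≢r = ≤-reflexive (≡.sym (par-ρ v v≢r))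

  suc⇒≢root : ∀ {v k} → ρ v ≡ suc k → v ≢ r
  suc⇒≢root e refl with () ← trans (≡.sym ρ-root) e

  ≢root⇒0< : ∀ {v} → v ≢ r → 0 < ρ v
  ≢root⇒0< {v} v≢r rewrite par-ρ v v≢r = s≤s z≤n

  Anc⇒≤ : ∀ {a v} → Anc a v → ρ a ≤ ρ v
  Anc⇒≤ base        = ≤-refl
  Anc⇒≤ (up {v} ne p) = ≤-trans (Anc⇒≤ p) (<⇒≤ (par-< v ne))

  ¬Anc-root : ∀ {a} → a ≢ r → ¬ Anc a r
  ¬Anc-root a≢r base      = a≢r refl
  ¬Anc-root a≢r (up ne _) = ne refl

  ρ-induction : (P : Fin n → Set) → P r → (∀ v → v ≢ r → P (par v) → P v) → ∀ v → P v
  ρ-induction P pr next v = go (ρ v) v ≤-refl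
    where
    go : ∀ k v → ρ v ≤ k → P v
    go k v le with v ≟ᶠ r
    go k       v le | yes refl = pr
    go zero    v le | no ne = contradiction (ρ≡0 v (n≤0⇒n≡0 le)) ne
    go (suc k) v le | no ne = next v ne (go k (par v) (≤-pred (≤-trans (par-< v ne) le)))

  anc? : ∀ a v → Dec (Anc a v)
  anc? a = ρ-induction (Dec ∘ Anc a) root next
    where
    root : Dec (Anc a r)
    root with a ≟ᶠ r
    ... | yes refl = yes base
    ... | no ne    = no (¬Anc-root ne)
    next : ∀ v → v ≢ r → Dec (Anc a (par v)) → Dec (Anc a v)
    next v ne (yes p) = yes (up ne p)
    next v ne (no ¬p) with a ≟ᶠ v
    ... | yes refl = yes base
    ... | no a≢v   = no λ where
      base     → a≢v refl
      (up _ p) → ¬p p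

  climb : ∀ v k → k ≤ ρ v → ∃[ a ] (ρ a ≡ k × Anc a v)
  climb v k = ρ-induction (λ v → k ≤ ρ v → ∃[ a ] (ρ a ≡ k × Anc a v)) root next v
    where
    root : k ≤ ρ r → ∃[ a ] (ρ a ≡ k × Anc a r)
    root le = r , ≤-antisym (≤-trans (≤-reflexive ρ-root) z≤n) le , base
    next : ∀ v → v ≢ r → (k ≤ ρ (par v) → ∃[ a ] (ρ a ≡ k × Anc a (par v))) →
           k ≤ ρ v → ∃[ a ] (ρ a ≡ k × Anc a v)
    next v ne ih le with k ≤? ρ (par v)
    ... | yes le′ with ih le′
    ...   | a , e , p = a , e , up ne p
    next v ne ih le | no ¬le = v , ≤-antisym (≤-trans (≤-reflexive (par-ρ v ne)) (≰⇒> ¬le)) le , base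

  -- A parent path never leaves the levels up to `k`, so only parent edges there must survive. The
  -- relation is arbitrary in order to cover both modified graphs and walks avoiding a vertex.
  star-root : {_~_ : Fin n → Fin n → Set} (k : ℕ) → (∀ v → v ≢ r → ρ v ≤ k → v ~ par v) →
              ∀ v → ρ v ≤ k → Star _~_ v r
  star-root {_~_} k edge = ρ-induction (λ v → ρ v ≤ k → Star _~_ v r) (λ _ → ε)
    λ v ne ih le → edge v ne le ◅ ih (≤-trans (<⇒≤ (par-< v ne)) le)

  star-anc : {_~_ : Fin n → Fin n → Set} {a : Fin n} → (∀ v → v ≢ r → ρ a < ρ v → v ~ par v) →
             ∀ {v} → Anc a v → Star _~_ v a
  star-anc edge base          = ε
  star-anc edge (up {v} ne p) = edge v ne (≤-<-trans (Anc⇒≤ p) (par-< v ne)) ◅ star-anc edge p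

  child⇒2≤degree : ∀ {v w} → v ≢ r → Adjacent T v w → ρ v < ρ w → 2 ≤ degree T v
  child⇒2≤degree {v} {w} ne vw lt = neighbours⇒2≤degree T
    (λ { refl → <-asym lt (par-< v ne) }) vw (par-adj v ne)

  par-adj′ : ∀ v → v ≢ r → Adjacent T (par v) v
  par-adj′ v ne = Adj-sym T (par-adj v ne)

-- Trees

module _ {T : Graph n} {r : Fin n} (R : Rooted T r) where
  open RootedProperties R

  TreeEdge : Fin n → Fin n → Set
  TreeEdge v w = (v ≢ r × par v ≡ w) ⊎ (w ≢ r × par w ≡ v)

  treeEdge? : ∀ v w → Dec (TreeEdge v w)
  treeEdge? v w = (¬? (v ≟ᶠ r) ×-dec (par v ≟ᶠ w)) ⊎-dec (¬? (w ≟ᶠ r) ×-dec (par w ≟ᶠ v))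

  -- All parent edges survive the deletion, so both ends still reach each other through the root.
  conn-removeNonTreeEdge : Conn T → ∀ {v w} → ¬ TreeEdge v w → Conn (remove T v w)
  conn-removeNonTreeEdge conn {v} {w} ¬te = conn-remove T conn
    (star-root (ρ v) keep v ≤-refl ◅◅ star-sym (remove T v w) (star-root (ρ w) keep w ≤-refl))
    where
    keep : ∀ {k} z → z ≢ r → ρ z ≤ k → Adjacent (remove T v w) z (par z)
    keep z ne _ = remove-keeps T (par-adj z ne) λ where
      (inj₁ (refl , e)) → ¬te (inj₁ (ne , e))
      (inj₂ (refl , e)) → ¬te (inj₂ (ne , e))

-- Every root is quantified over because later arguments root the same tree at different ends.
Tree : (T : Graph n) → Conn T → Set
Tree T conn = ∀ r v w → Adjacent T v w → TreeEdge (rooted T conn r) v w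

-- This dichotomy lets the descent run through connected spanning subgraphs: acyclicity never has to
-- be carried through an exchange, since a failure of it yields an edge to delete.
tree-or-redundantEdge : (T : Graph n) (conn : Conn T) →
                        Tree T conn ⊎ ∃[ v ] ∃[ w ] (Adjacent T v w × Conn (remove T v w))
tree-or-redundantEdge T conn
  with any? (λ r → any? (λ v → any? (λ w → adj? T v w ×-dec ¬? (treeEdge? (rooted T conn r) v w))))
... | yes (r , v , w , vw , ¬te) = inj₂ (v , w , vw , conn-removeNonTreeEdge (rooted T conn r) conn ¬te)
... | no none = inj₁ tree
  where
  tree : Tree T conn
  tree r v w vw with treeEdge? (rooted T conn r) v w
  ... | yes te = te
  ... | no ¬te = contradiction (r , v , w , vw , ¬te) none

private
  closedWalk⇒length≤1 : {T : Graph n} {v : Fin n} {vs : List (Fin n)} → Walk T v v vs → Unique vs → length vs ≤ 1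
  closedWalk⇒length≤1 (here _)   _          = ≤-refl
  closedWalk⇒length≤1 (step _ W) (v∉ ∷ _) = ⊥-elim (endpoint W v∉)
    where
    endpoint : ∀ {T : Graph n} {w v vs} → Walk T w v vs → ¬ All (v ≢_) vs
    endpoint (here _)   (ne ∷ _)  = ne refl
    endpoint (step _ W) (_ ∷ ne)  = endpoint W ne

  walk-head : {T : Graph n} {u w v : Fin n} {vs : List (Fin n)} → Walk T w v vs → All (u ≢_) vs → u ≢ w
  walk-head (here _)   (ne ∷ _) = ne
  walk-head (step _ _) (ne ∷ _) = ne

-- Root at the first vertex `u` of the cycle. After the step to its child `w` the walk avoids `u`,
-- so it stays among the descendants of `w`. Its last vertex is also a child of `u`, hence equals
-- `w`, and the cycle is too short.
tree⇒acyclic : (T : Graph n) (conn : Conn T) → Tree T conn → ¬ HasCycle T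
tree⇒acyclic T conn tree (u , _ , _ , here _ , _ , s≤s () , _)
tree⇒acyclic {n} T conn tree (u , v , _ , step {w = w} uw W , u∉ ∷ unique , 3≤ , vu) = contra
  where
  open RootedProperties (rooted T conn u)
  childOfRoot : ∀ {z} → Adjacent T u z → z ≢ u × par z ≡ u
  childOfRoot uz with tree u u _ uz
  ... | inj₁ (ne , _) = contradiction refl ne
  ... | inj₂ te       = te
  stay : ∀ {z vs} → Anc w z → Walk T z v vs → All (u ≢_) vs → Anc w v
  stay p (here _) _ = p
  stay {z} p (step {w = z′} zz′ W) (_ ∷ ne) with tree u z z′ zz′
  ... | inj₂ (z′≢u , refl) = stay (up z′≢u p) W ne
  ... | inj₁ (z≢u , refl) with p
  ...   | base   = contradiction (≡.sym (proj₂ (childOfRoot uw))) (walk-head W ne)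
  ...   | up _ q = stay q W ne
  contra : ⊥
  contra with stay base W u∉
  ... | base   = <⇒≱ 3≤ (s≤s (closedWalk⇒length≤1 W unique))
  ... | up _ p = ¬Anc-root (proj₁ (childOfRoot uw)) (subst (Anc w) (proj₂ (childOfRoot (Adj-sym T vu))) p)

-- Edge exchange

swap : Graph n → (c d x y : Fin n) → x ≢ y → Graph n
swap T c d x y x≢y = insert (remove T c d) x y x≢y

swap-⊆ : (T G : Graph n) {c d x y : Fin n} {x≢y : x ≢ y} → Subgraph T G → Adjacent G x y → Subgraph (swap T c d x y x≢y) G
swap-⊆ T G {c} {d} {x≢y = x≢y} T⊆G xy =
  insert-⊆ (remove T c d) G {x≢y = x≢y} (λ v w e → T⊆G v w (remove-⊆ T {c} {d} v w e)) xy

swap-keeps : (T : Graph n) {c d x y v w : Fin n} {x≢y : x ≢ y} → Adjacent T v w → ¬ IsEdge c d v w →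
             Adjacent (swap T c d x y x≢y) v w
swap-keeps T {c} {d} {x≢y = x≢y} vw ¬e = insert-keeps (remove T c d) {x≢y = x≢y} (remove-keeps T vw ¬e)

degree-swap : (T : Graph n) {c d x y : Fin n} {x≢y : x ≢ y} → Adjacent T c d → ¬ Adjacent T x y → ∀ v →
              degree (swap T c d x y x≢y) v + (δ v c + δ v d) ≡ degree T v + (δ v x + δ v y)
degree-swap T {c} {d} {x} {y} {x≢y} cd ¬xy v = begin-equality
  degree (swap T c d x y x≢y) v + C    ≡⟨ cong (_+ C) (degree-insert T₀ x≢y (¬xy ∘ remove-⊆ T {c} {d} x y) v) ⟩
  degree T₀ v + X + C                  ≡⟨ +-assoc (degree T₀ v) X C ⟩
  degree T₀ v + (X + C)                ≡⟨ cong (degree T₀ v +_) (+-comm X C) ⟩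
  degree T₀ v + (C + X)                ≡⟨ +-assoc (degree T₀ v) C X ⟨
  degree T₀ v + C + X                  ≡⟨ cong (_+ X) (degree-remove T cd v) ⟨
  degree T v + X                       ∎
  where
  T₀ = remove T c d
  C = δ v c + δ v d
  X = δ v x + δ v y

-- Twice the number of edges, by the handshake lemma; as a degree sum it follows directly from the
-- degree identities.
size : Graph n → ℕ
size T = sum (degree T)

size-remove : (T : Graph n) {c d : Fin n} → Adjacent T c d → size (remove T c d) < size T
size-remove T {c} {d} cd = begin-strict
  size T₀                                         <⟨ m<m+n (size T₀) (s≤s z≤n) ⟩
  size T₀ + 2                                     ≡⟨ sum-+2δ (degree T₀) c d ⟨
  sum (λ v → degree T₀ v + (δ v c + δ v d))       ≡⟨ sum-cong-≗ (degree-remove T cd) ⟨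
  size T                                          ∎
  where T₀ = remove T c d

size-swap : (T : Graph n) {c d x y : Fin n} {x≢y : x ≢ y} → Adjacent T c d → ¬ Adjacent T x y →
            size (swap T c d x y x≢y) ≡ size T
size-swap T {c} {d} {x} {y} {x≢y} cd ¬xy = +-cancelʳ-≡ 2 _ _ (begin-equality
  size T′ + 2                                     ≡⟨ sum-+2δ (degree T′) c d ⟨
  sum (λ v → degree T′ v + (δ v c + δ v d))       ≡⟨ sum-cong-≗ (degree-swap T {x≢y = x≢y} cd ¬xy) ⟩
  sum (λ v → degree T v + (δ v x + δ v y))        ≡⟨ sum-+2δ (degree T) x y ⟩
  size T + 2                                      ∎)
  where T′ = swap T c d x y x≢y

-- The deleted edge is replaced by a detour: from `b` down to its descendant `y`, across the new
-- edge to the root `x`, and from there to `par b`. The first piece uses parent edges of vertices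
-- deeper than `b`, the last one those of vertices no deeper than `par b`, so neither needs the
-- deleted edge.
conn-swap : (T : Graph n) → Conn T → ∀ {x y b} (x≢y : x ≢ y) (R : Rooted T x) → let open RootedProperties R in
            b ≢ x → Anc b y → Conn (swap T b (par b) x y x≢y)
conn-swap {n} T conn {x} {y} {b} x≢y R b≢x b-y = conn-reroute T T′ conn edge
  where
  open RootedProperties R
  T′ = swap T b (par b) x y x≢y
  upper : ∀ z → z ≢ x → ρ b < ρ z → Adjacent T′ z (par z)
  upper z ne lt = swap-keeps T {x≢y = x≢y} (par-adj z ne) λ where
    (inj₁ (refl , _)) → <-irrefl refl lt
    (inj₂ (refl , _)) → <-asym lt (par-< b b≢x)
  lower : ∀ z → z ≢ x → ρ z ≤ ρ (par b) → Adjacent T′ z (par z)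
  lower z ne le = swap-keeps T {x≢y = x≢y} (par-adj z ne) λ where
    (inj₁ (refl , _)) → <⇒≱ (par-< b b≢x) le
    (inj₂ (refl , e)) → <-asym (par-< b b≢x) (subst (λ a → ρ a < ρ (par b)) e (par-< (par b) ne))
  detour : Star (Adjacent T′) b (par b)
  detour = star-sym T′ (star-anc upper b-y)
        ◅◅ Adj-sym T′ (insert-new (remove T b (par b)) {x≢y = x≢y})
        ◅ star-sym T′ (star-root (ρ (par b)) lower (par b) ≤-refl)
  edge : ∀ {v w} → Adjacent T v w → Star (Adjacent T′) v w
  edge {v} {w} vw with isEdge? b (par b) v w
  ... | yes (inj₁ (refl , refl)) = detour
  ... | yes (inj₂ (refl , refl)) = star-sym T′ detour
  ... | no ¬e = swap-keeps T {x≢y = x≢y} vw ¬e ◅ ε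

-- Leaves and branch vertices

φ : ℕ → ℕ
φ d = ⟦ does (d ≟ 1) ⟧ + ⟦ does (3 ≤? d) ⟧

φ≤1 : ∀ d → φ d ≤ 1
φ≤1 0 = z≤n
φ≤1 1 = ≤-refl
φ≤1 2 = z≤n
φ≤1 (suc (suc (suc d))) = ≤-refl

φ-branch : ∀ {d} → 3 ≤ d → φ d ≡ 1
φ-branch (s≤s (s≤s (s≤s _))) = refl

cost : Graph n → ℕ
cost T = sum (φ ∘ degree T)

cost≡ : (T : Graph n) → cost T ≡ numEnd T + numBranch T
cost≡ T = trans (∑-distrib-+ (λ v → ⟦ does (degree T v ≟ 1) ⟧) _)
  (≡.sym (cong₂ _+_ (count≡sum (λ v → does (degree T v ≟ 1))) (count≡sum (λ v → does (3 ≤? degree T v)))))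

sum-δ* : (y : Fin n) (g : ℕ) → sum (λ v → δ v y * g) ≡ g
sum-δ* {suc n} fzero g = trans (cong (g + 0 +_) (sum-replicate-zero n)) (trans (+-identityʳ _) (+-identityʳ g))
sum-δ* {suc n} (fsuc y) g = sum-δ* y g

-- Degree bookkeeping for replacing the edge `b b′` by `x y`, where `x` is an end. The case
-- `x ≡ b′`, a leg consisting of one edge, is included.
module Exchange (T T′ : Graph n) {x y b b′ : Fin n}
         (degrees : ∀ v → degree T′ v + (δ v b + δ v b′) ≡ degree T v + (δ v x + δ v y))
         (x≢y : x ≢ y) (x≢b : x ≢ b) (y≢b : y ≢ b) (y≢b′ : y ≢ b′) (b≢b′ : b ≢ b′)
         (x-leaf : degree T x ≡ 1)
         where

  branch-degree : suc (degree T′ b) ≡ degree T b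
  branch-degree with degrees b
  ... | D rewrite δ-refl b | δ-≢ b≢b′ | δ-≢ (x≢b ∘ ≡.sym) | δ-≢ (y≢b ∘ ≡.sym) =
    trans (+-comm 1 (degree T′ b)) (trans D (+-identityʳ _))

  unchanged-degree : ∀ {v} → v ≢ x → v ≢ y → v ≢ b → v ≢ b′ → degree T′ v ≡ degree T v
  unchanged-degree {v} v≢x v≢y v≢b v≢b′ with degrees v
  ... | D rewrite δ-≢ v≢x | δ-≢ v≢y | δ-≢ v≢b | δ-≢ v≢b′ = +-cancelʳ-≡ 0 _ _ D

  -- Only `x` and `y` can gain degree; `x` reaches at most 2 and `y` is a branch vertex already.
  -- This carries `Outermost` over to `T′`.
  branch-reflect : 3 ≤ degree T y → ∀ v → 3 ≤ degree T′ v → 3 ≤ degree T v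
  branch-reflect y-branch v v-branch with v ≟ᶠ x | v ≟ᶠ y | degrees v
  ... | yes refl | yes e    | _ = contradiction e x≢y
  ... | yes refl | no _     | D rewrite x-leaf = contradiction (≤-trans (m≤m+n _ _) (≤-reflexive D)) (<⇒≱ v-branch)
  ... | no _     | yes refl | _ = y-branch
  ... | no _     | no _     | D =
    ≤-trans v-branch (≤-trans (m≤m+n _ _) (≤-trans (≤-reflexive D) (≤-reflexive (+-identityʳ _))))

  -- gy and gb are what y and b contribute to the decrease of the cost.
  module _ (gy gb : ℕ)
         (gain-y : φ (degree T y + 1) + gy ≤ φ (degree T y))
         (gain-b : ∀ d → d + 1 ≡ degree T b → φ d + gb ≤ φ (degree T b)) where
    private
      pointwise : ∀ v → φ (degree T′ v) + (δ v x + (δ v y * gy + δ v b * gb)) ≤ φ (degree T v) + δ v b′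
      pointwise v with v ≟ᶠ x | v ≟ᶠ y | v ≟ᶠ b | v ≟ᶠ b′ | degrees v
      ... | yes refl | yes e    | _        | _       | _ = contradiction e x≢y
      ... | yes refl | no _     | yes e    | _       | _ = contradiction e x≢b
      -- Here `x` is `b′`: it loses one edge, gains one and remains an end, and the allowance
      -- `δ v b′` pays for `δ v x`.
      ... | yes refl | no _     | no _     | yes _   | D rewrite +-cancelʳ-≡ 1 _ _ D = ≤-refl
      ... | yes refl | no _     | no _     | no _    | D rewrite trans (≡.sym (+-identityʳ _)) D | x-leaf = ≤-refl
      ... | no _     | yes refl | yes e    | _       | _ = contradiction e y≢b
      ... | no _     | yes refl | no _     | yes e   | _ = contradiction e y≢b′
      ... | no _     | yes refl | no _     | no _    | D
        rewrite trans (≡.sym (+-identityʳ _)) D | +-identityʳ gy | +-identityʳ gy | +-identityʳ (φ (degree T y)) = gain-y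
      ... | no _     | no _     | yes refl | yes e   | _ = contradiction e b≢b′
      ... | no _     | no _     | yes refl | no _    | D
        rewrite +-identityʳ gb | +-identityʳ (φ (degree T b)) = gain-b _ (trans D (+-identityʳ _))
      ... | no _     | no _     | no _     | yes _   | D
        rewrite +-identityʳ (φ (degree T′ v)) = ≤-trans (φ≤1 (degree T′ v)) (m≤n+m 1 _)
      ... | no _     | no _     | no _     | no _    | D rewrite +-cancelʳ-≡ 0 _ _ D = ≤-refl

    -- The end `x` gains a neighbour and saves one, while `b′` loses a neighbour and costs at most
    -- one more. These cancel (also when `x ≡ b′`), leaving only the changes at `y` and `b`.
    cost-exchange : cost T′ + (gy + gb) ≤ cost T
    cost-exchange = +-cancelʳ-≤ 1 _ _ (begin
      cost T′ + (gy + gb) + 1       ≡⟨ +-assoc (cost T′) (gy + gb) 1 ⟩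
      cost T′ + (gy + gb + 1)       ≡⟨ cong (cost T′ +_) (+-comm (gy + gb) 1) ⟩
      cost T′ + (1 + (gy + gb))
        ≡⟨ cong₂ (λ p q → cost T′ + (p + q)) (sum-δ x) (cong₂ _+_ (sum-δ* y gy) (sum-δ* b gb)) ⟨
      cost T′ + (sum (λ v → δ v x) + (sum (λ v → δ v y * gy) + sum (λ v → δ v b * gb)))
        ≡⟨ cong (λ q → cost T′ + (sum (λ v → δ v x) + q)) (∑-distrib-+ (λ v → δ v y * gy) _) ⟨
      cost T′ + (sum (λ v → δ v x) + sum (λ v → δ v y * gy + δ v b * gb))
        ≡⟨ cong (cost T′ +_) (∑-distrib-+ (λ v → δ v x) _) ⟨
      cost T′ + sum (λ v → δ v x + (δ v y * gy + δ v b * gb))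
        ≡⟨ ∑-distrib-+ (φ ∘ degree T′) _ ⟨
      sum (λ v → φ (degree T′ v) + (δ v x + (δ v y * gy + δ v b * gb)))
        ≤⟨ sum-mono-≤ pointwise ⟩
      sum (λ v → φ (degree T v) + δ v b′)
        ≡⟨ sum-+δ (φ ∘ degree T) b′ ⟩
      cost T + 1                    ∎)

module _ (T T′ : Graph n) {u w s : Fin n}
         (degrees : ∀ v → degree T′ v + (δ v w + δ v s) ≡ degree T v + (δ v u + δ v w))
         where

  -- `w` trades its neighbour `s` for `u`, so its own degree is unchanged and the term `δ v w`
  -- cancels.
  degree-slide : ∀ v → degree T′ v + δ v s ≡ degree T v + δ v u
  degree-slide v = +-cancelʳ-≡ (δ v w) _ _ (begin-equality
    degree T′ v + δ v s + δ v w     ≡⟨ +-assoc (degree T′ v) _ _ ⟩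
    degree T′ v + (δ v s + δ v w)   ≡⟨ cong (degree T′ v +_) (+-comm (δ v s) _) ⟩
    degree T′ v + (δ v w + δ v s)   ≡⟨ degrees v ⟩
    degree T v + (δ v u + δ v w)    ≡⟨ +-assoc (degree T v) _ _ ⟨
    degree T v + δ v u + δ v w      ∎)

  -- The end `u` gets degree 2 and saves one; `g` bounds the rise at `s`.
  cost-slide : u ≢ s → degree T u ≡ 1 → ∀ g → (∀ d → d + 1 ≡ degree T s → φ d ≤ φ (degree T s) + g) → cost T′ + 1 ≤ cost T + g
  cost-slide u≢s u-leaf g loss = begin
    cost T′ + 1                                      ≡⟨ sum-+δ (φ ∘ degree T′) u ⟨
    sum (λ v → φ (degree T′ v) + δ v u)              ≤⟨ sum-mono-≤ pointwise ⟩
    sum (λ v → φ (degree T v) + δ v s * g)           ≡⟨ ∑-distrib-+ (φ ∘ degree T) _ ⟩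
    cost T + sum (λ v → δ v s * g)                   ≡⟨ cong (cost T +_) (sum-δ* s g) ⟩
    cost T + g                                       ∎
    where
    pointwise : ∀ v → φ (degree T′ v) + δ v u ≤ φ (degree T v) + δ v s * g
    pointwise v with v ≟ᶠ u | v ≟ᶠ s | degree-slide v
    ... | yes refl | yes e    | _ = contradiction e u≢s
    ... | yes refl | no _     | D rewrite trans (≡.sym (+-identityʳ _)) D | u-leaf = ≤-refl
    ... | no _     | yes refl | D rewrite +-identityʳ g | +-identityʳ (φ (degree T′ v)) =
      loss _ (trans D (+-identityʳ _))
    ... | no _     | no _     | D rewrite +-cancelʳ-≡ 0 _ _ D = ≤-refl

-- Levels below the nearest branch vertex

module Nearest (T : Graph n) {x : Fin n} (R : Rooted T x) (x-leaf : degree T x ≡ 1)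
               (m : ℕ) (far : ∀ z → 3 ≤ degree T z → m ≤ Rooted.ρ R z) where
  open RootedProperties R

  -- By induction two vertices of level `k + 1` share their parent. If it is the end `x`, it has too
  -- many neighbours; otherwise its own parent is a third neighbour, making it a branch vertex at a
  -- level below `m`.
  level-unique : ∀ k → k ≤ m → ∀ {v w} → ρ v ≡ k → ρ w ≡ k → v ≡ w
  level-unique zero    _  ev ew = trans (ρ≡0 _ ev) (≡.sym (ρ≡0 _ ew))
  level-unique (suc k) le {v} {w} ev ew with v ≟ᶠ w
  ... | yes e   = e
  ... | no v≢w = ⊥-elim absurd
    where
    v≢x = suc⇒≢root ev
    w≢x = suc⇒≢root ew
    level : ∀ {z} → z ≢ x → ρ z ≡ suc k → ρ (par z) ≡ k
    level {z} ne e = suc-injective (trans (≡.sym (par-ρ z ne)) e)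
    same : par w ≡ par v
    same = level-unique k (<⇒≤ le) (level w≢x ew) (level v≢x ev)
    p = par v
    pv : Adjacent T p v
    pv = par-adj′ v v≢x
    pw : Adjacent T p w
    pw = subst (λ q → Adjacent T q w) same (par-adj′ w w≢x)
    notParent : ∀ {z} → p ≢ x → ρ z ≡ suc k → z ≢ par p
    notParent ne e refl = <-asym (par-< p ne) (≤-reflexive (trans (cong suc (level v≢x ev)) (≡.sym e)))
    absurd : ⊥
    absurd with p ≟ᶠ x
    ... | yes e = <⇒≱ (neighbours⇒2≤degree T v≢w pv pw)
                      (≤-reflexive (trans (cong (degree T) e) x-leaf))
    ... | no ne = <⇒≱ (≤-trans (s≤s (≤-reflexive (level v≢x ev))) le)
                      (far p (neighbours⇒3≤degree T v≢w (notParent ne ev) (notParent ne ew) pv pw (par-adj p ne)))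

  -- The ancestor of `w` one level beyond `y` has `y` as parent, by uniqueness of levels. So `y` has
  -- degree at least 2, hence at least 3, at a level below `m`.
  noShallowEnd : ∀ {y} → y ≢ x → degree T y ≢ 2 → ∀ {w} → ρ w ≤ m → ¬ ρ y < ρ w
  noShallowEnd {y} y≢x ≢2 {w} le lt with climb w (suc (ρ y)) lt
  ... | a , ea , _ = <⇒≱ (≤-trans lt le) (far y (≤∧≢⇒< (child⇒2≤degree y≢x ya (≤-reflexive (≡.sym ea))) (≢2 ∘ ≡.sym)))
    where
    a≢x = suc⇒≢root ea
    ya : Adjacent T y a
    ya = subst (λ q → Adjacent T q a)
      (level-unique (ρ y) (≤-trans (<⇒≤ lt) le) (suc-injective (trans (≡.sym (par-ρ a a≢x)) ea)) refl)
      (par-adj′ a a≢x)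

  -- Such a `y` is at least as deep as `b`, and its ancestor at the level of `b` can only be `b`.
  nearest-separates : ∀ {b} → ρ b ≡ m → ∀ {y} → y ≢ x → degree T y ≢ 2 → Anc b y
  nearest-separates {b} eb {y} y≢x ≢2 with climb y (ρ b) (≮⇒≥ (noShallowEnd y≢x ≢2 (≤-reflexive eb)))
  ... | a , ea , p rewrite level-unique (ρ b) (≤-reflexive eb) {b} {a} refl ea = p

-- Seen from an end `x`, every level has at most one vertex, and any further end is the deepest
-- vertex, so there is at most one.
noBranch⇒cost≤2 : (T : Graph n) → Conn T → ¬ (∃[ b ] 3 ≤ degree T b) → cost T ≤ 2
noBranch⇒cost≤2 {n} T conn none with any? (λ x → degree T x ≟ 1)
... | no noLeaf = ≤-trans (≤-reflexive (sum-zero λ v → cong₂ _+_ (⟦no⟧ (degree T v ≟ 1) (λ e → noLeaf (v , e)))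
                                                              (⟦no⟧ (3 ≤? degree T v) (λ e → none (v , e))))) z≤n
... | yes (x , x-leaf) with any? (λ y → (degree T y ≟ 1) ×-dec ¬? (y ≟ᶠ x))
...   | no noSecond = begin
    cost T              ≤⟨ sum-mono-≤ pointwise ⟩
    sum (λ v → δ v x)   ≡⟨ sum-δ x ⟩
    1                   ≤⟨ s≤s z≤n ⟩
    2                   ∎
    where
    pointwise : ∀ v → φ (degree T v) ≤ δ v x
    pointwise v with v ≟ᶠ x
    ... | yes _ = φ≤1 (degree T v)
    ... | no ne = ≤-reflexive (cong₂ _+_ (⟦no⟧ (degree T v ≟ 1) (λ e → noSecond (v , e , ne)))
                                         (⟦no⟧ (3 ≤? degree T v) (λ e → none (v , e))))
...   | yes (y , y-leaf , y≢x) = begin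
    cost T                       ≤⟨ sum-mono-≤ pointwise ⟩
    sum (λ v → δ v x + δ v y)    ≡⟨ sum-+δ (λ v → δ v x) y ⟩
    sum (λ v → δ v x) + 1        ≡⟨ cong (_+ 1) (sum-δ x) ⟩
    2                            ∎
    where
    R = rooted T conn x
    open RootedProperties R
    unique : ∀ {z} → z ≢ x → degree T z ≡ 1 → z ≡ y
    unique {z} z≢x z-leaf = level-unique _ (m≤m+n _ (ρ y)) refl
      (≤-antisym (≮⇒≥ (noShallowEnd z≢x (≢2 z-leaf) {y} (m≤n+m _ (ρ z))))
                 (≮⇒≥ (noShallowEnd y≢x (≢2 y-leaf) {z} (m≤m+n _ (ρ y)))))
      where
      -- Without branch vertices any bound is admissible; this one dominates both levels.
      open Nearest T R x-leaf (ρ z + ρ y) (λ b br → contradiction (b , br) none)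
      ≢2 : ∀ {v} → degree T v ≡ 1 → degree T v ≢ 2
      ≢2 e e′ with () ← trans (≡.sym e) e′
    pointwise : ∀ v → φ (degree T v) ≤ δ v x + δ v y
    pointwise v with v ≟ᶠ x | v ≟ᶠ y
    ... | yes _ | _     = ≤-trans (φ≤1 (degree T v)) (m≤m+n 1 _)
    ... | no _  | yes _ = φ≤1 (degree T v)
    ... | no v≢x | no v≢y = ≤-reflexive (cong₂ _+_ (⟦no⟧ (degree T v ≟ 1) (λ e → v≢y (unique v≢x e)))
                                         (⟦no⟧ (3 ≤? degree T v) (λ e → none (v , e))))

-- Exchanges that lower the cost.

Better : Graph n → Graph n → Set
Better G T = ∃[ T′ ] (Conn T′ × Subgraph T′ G × size T′ ≡ size T × cost T′ < cost T)

leaf⇒≢2 : ∀ {d} → d ≡ 1 → d ≢ 2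
leaf⇒≢2 refl ()

branch⇒≢2 : ∀ {d} → 3 ≤ d → d ≢ 2
branch⇒≢2 (s≤s (s≤s ())) refl

leaf≢branch : (T : Graph n) {x b : Fin n} → degree T x ≡ 1 → 3 ≤ degree T b → x ≢ b
leaf≢branch T x-leaf b-branch refl = <⇒≱ b-branch (≤-trans (≤-reflexive x-leaf) (s≤s z≤n))

-- The leg of x, cut off at its nearest branch vertex b, is re-attached by the edge xy.
module LegSwap (G T : Graph n) (conn : Conn T) (T⊆G : Subgraph T G) {x b : Fin n}
               (x-leaf : degree T x ≡ 1) (b-branch : 3 ≤ degree T b)
               (nearest : ∀ z → 3 ≤ degree T z → Rooted.ρ (rooted T conn x) b ≤ Rooted.ρ (rooted T conn x) z)
               {y : Fin n} (x≢y : x ≢ y) (y≢b : y ≢ b) (y≢2 : degree T y ≢ 2) (xy : Adjacent G x y) where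
  private R = rooted T conn x
  open RootedProperties R
  open Nearest T R x-leaf (ρ b) nearest

  b′ : Fin n
  b′ = par b

  T′ : Graph n
  T′ = swap T b b′ x y x≢y

  private
    x≢b : x ≢ b
    x≢b = leaf≢branch T x-leaf b-branch

    b≢x : b ≢ x
    b≢x = x≢b ∘ ≡.sym

    b-y : Anc b y
    b-y = nearest-separates refl (x≢y ∘ ≡.sym) y≢2

    bb′ : Adjacent T b b′
    bb′ = par-adj b b≢x

    ¬xy : ¬ Adjacent T x y
    ¬xy adj-xy with b-y
    ... | base   = y≢b refl
    -- `y` lies strictly beyond `b`, hence at distance at least 2 from `x`.
    ... | up ne p = <⇒≱ (≤-<-trans (≤-trans (≢root⇒0< b≢x) (Anc⇒≤ p)) (par-< y ne))
                        (≤-trans (ρ-lip adj-xy) (≤-reflexive (cong suc ρ-root)))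

  connected : Conn T′
  connected = conn-swap T conn x≢y R b≢x b-y

  subgraph : Subgraph T′ G
  subgraph = swap-⊆ T G {x≢y = x≢y} T⊆G xy

  sameSize : size T′ ≡ size T
  sameSize = size-swap T {x≢y = x≢y} bb′ ¬xy

  degrees : ∀ v → degree T′ v + (δ v b + δ v b′) ≡ degree T v + (δ v x + δ v y)
  degrees = degree-swap T {x≢y = x≢y} bb′ ¬xy

  b≢b′ : b ≢ b′
  b≢b′ = Adj⇒≢ T bb′

  y≢b′ : y ≢ b′
  y≢b′ e = <⇒≱ (par-< b b≢x) (≤-trans (Anc⇒≤ b-y) (≤-reflexive (cong ρ e)))

  leaf≢b′ : ∀ {u} → degree T u ≡ 1 → u ≢ x → u ≢ b′
  leaf≢b′ u-leaf u≢x refl = <⇒≱ (child⇒2≤degree u≢x (par-adj′ b b≢x) (par-< b b≢x)) (≤-reflexive u-leaf)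

  open Exchange T T′ degrees x≢y x≢b y≢b y≢b′ b≢b′ x-leaf public

-- Re-attaching the leg of `x` at `y` raises `y` to degree 2, which saves one; `b` was already
-- counted, so losing a neighbour cannot make it dearer.
adjacentLeaves⇒better : (G T : Graph n) → Conn T → Subgraph T G → {x y : Fin n} →
                        degree T x ≡ 1 → degree T y ≡ 1 → Adjacent G x y → ∃[ b ] 3 ≤ degree T b → Better G T
adjacentLeaves⇒better G T conn T⊆G {x} {y} x-leaf y-leaf xy branch
  with argmin (λ v → 3 ≤? degree T v) (Rooted.ρ (rooted T conn x)) branch
... | b , b-branch , nearest = T′ , connected , subgraph , sameSize ,
    ≤-trans (≤-reflexive (+-comm 1 (cost T′))) (cost-exchange 1 0 gain-y gain-b)
  where
  open LegSwap G T conn T⊆G x-leaf b-branch nearest (Adj⇒≢ G xy) (leaf≢branch T y-leaf b-branch) (leaf⇒≢2 y-leaf) xy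
  gain-y : φ (degree T y + 1) + 1 ≤ φ (degree T y)
  gain-y rewrite y-leaf = ≤-refl
  gain-b : ∀ d → d + 1 ≡ degree T b → φ d + 0 ≤ φ (degree T b)
  gain-b d _ rewrite φ-branch b-branch | +-identityʳ (φ d) = φ≤1 d

module Slide (G T : Graph n) (conn : Conn T) (T⊆G : Subgraph T G) {u w : Fin n}
             (u-leaf : degree T u ≡ 1) (uw : Adjacent G u w) (¬uw : ¬ Adjacent T u w) where
  private R = rooted T conn u
  open RootedProperties R

  s : Fin n
  s = par w

  private
    u≢w = Adj⇒≢ G uw
    w≢u = u≢w ∘ ≡.sym
    ws : Adjacent T w s
    ws = par-adj w w≢u

  T′ : Graph n
  T′ = swap T w s u w u≢w

  u≢s : u ≢ s
  u≢s e = ¬uw (subst (λ q → Adjacent T q w) (≡.sym e) (Adj-sym T ws))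

  connected : Conn T′
  connected = conn-swap T conn u≢w R w≢u base

  subgraph : Subgraph T′ G
  subgraph = swap-⊆ T G {x≢y = u≢w} T⊆G uw

  sameSize : size T′ ≡ size T
  sameSize = size-swap T {x≢y = u≢w} ws ¬uw

  private
    swapped : ∀ v → degree T′ v + (δ v w + δ v s) ≡ degree T v + (δ v u + δ v w)
    swapped = degree-swap T {x≢y = u≢w} ws ¬uw

  degrees : ∀ v → degree T′ v + δ v s ≡ degree T v + δ v u
  degrees = degree-slide T T′ swapped

  cost-bound : ∀ g → (∀ d → d + 1 ≡ degree T s → φ d ≤ φ (degree T s) + g) → cost T′ + 1 ≤ cost T + g
  cost-bound = cost-slide T T′ swapped u≢s u-leaf

  -- `u` stops being an end, while `s` was already counted and contributes at most one afterwards.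
  branch⇒better : 3 ≤ degree T s → Better G T
  branch⇒better s-branch = T′ , connected , subgraph , sameSize ,
    ≤-trans (≤-reflexive (+-comm 1 (cost T′))) (≤-trans (cost-bound 0 loss) (≤-reflexive (+-identityʳ _)))
    where
    loss : ∀ d → d + 1 ≡ degree T s → φ d ≤ φ (degree T s) + 0
    loss d _ rewrite φ-branch s-branch = φ≤1 d

  -- Two exchanges in a row: sliding makes `s` an end in place of `u` without raising the cost,
  -- keeping `x` an end and `b` a branch vertex; then `x` and `s` are ends adjacent in `G`.
  adjacent⇒better : ∀ {x b} → degree T s ≡ 2 → degree T x ≡ 1 → x ≢ u → Adjacent G x s →
                    3 ≤ degree T b → Better G T
  adjacent⇒better {x} {b} s-2 x-leaf x≢u xs b-branch =
    case adjacentLeaves⇒better G T′ connected subgraph x-leaf′ s-leaf′ xs (b , b-branch′) of λ where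
      (T″ , c , sub , sz , lt) → T″ , c , sub , trans sz sameSize , <-≤-trans lt
        (+-cancelʳ-≤ 1 _ _ (cost-bound 1 (λ d _ → ≤-trans (φ≤1 d) (m≤n+m 1 _))))
    where
    unchanged : ∀ {v} → v ≢ s → v ≢ u → degree T′ v ≡ degree T v
    unchanged {v} v≢s v≢u = +-cancelʳ-≡ 0 _ _
      (trans (cong (degree T′ v +_) (≡.sym (δ-≢ v≢s))) (trans (degrees v) (cong (degree T v +_) (δ-≢ v≢u))))
    x-leaf′ : degree T′ x ≡ 1
    x-leaf′ = trans (unchanged (Adj⇒≢ G xs) x≢u) x-leaf
    s-leaf′ : degree T′ s ≡ 1
    s-leaf′ = +-cancelʳ-≡ 1 _ _ (trans (cong (degree T′ s +_) (≡.sym (δ-refl s)))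
      (trans (degrees s) (cong₂ _+_ s-2 (δ-≢ (u≢s ∘ ≡.sym)))))
    b-branch′ : 3 ≤ degree T′ b
    b-branch′ = ≤-trans b-branch (≤-reflexive (≡.sym (unchanged (λ { refl → branch⇒≢2 b-branch s-2 })
                                                             (leaf≢branch T u-leaf b-branch ∘ ≡.sym))))

-- Outermost branch vertices and their legs.

Avoiding : Graph n → Fin n → Fin n → Fin n → Set
Avoiding T b v w = Adjacent T v w × v ≢ b × w ≢ b

avoiding-sym : (T : Graph n) {b v w : Fin n} → Avoiding T b v w → Avoiding T b w v
avoiding-sym T (vw , v≢b , w≢b) = Adj-sym T vw , w≢b , v≢b

-- Walks avoiding b, unlike distances, are visibly unaffected when an edge at b is exchanged.
Outermost : Graph n → Fin n → Fin n → Set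
Outermost T u b = ∀ z → 3 ≤ degree T z → z ≢ b → Star (Avoiding T b) u z

-- After `z` the path to the root runs through levels strictly below `ρ z`, hence below `ρ b`.
rootPath-avoids : (T : Graph n) {r : Fin n} (R : Rooted T r) {b z : Fin n} →
                  z ≢ b → Rooted.ρ R z ≤ Rooted.ρ R b → Star (Avoiding T b) z r
rootPath-avoids T {r} R {b} {z} z≢b le with z ≟ᶠ r
... | yes refl = ε
... | no z≢r   = edge z z≢r z≢b le ◅ star-root (ρ (par z)) lower (par z) ≤-refl
  where
  open RootedProperties R
  edge : ∀ v → v ≢ r → v ≢ b → ρ v ≤ ρ b → Avoiding T b v (par v)
  edge v v≢r v≢b le′ = par-adj v v≢r , v≢b , λ e → <⇒≱ (par-< v v≢r) (≤-trans le′ (≤-reflexive (cong ρ (≡.sym e))))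
  lower : ∀ v → v ≢ r → ρ v ≤ ρ (par z) → Avoiding T b v (par v)
  lower v v≢r le′ = edge v v≢r (λ { refl → <⇒≱ lt ≤-refl }) (<⇒≤ lt)
    where
    lt : ρ v < ρ b
    lt = ≤-<-trans le′ (<-≤-trans (par-< z z≢r) le)

module _ (T : Graph n) (conn : Conn T) (tree : Tree T conn) where
  -- `D` is closed under children, so a deepest vertex of `D` has none and its parent is its only
  -- neighbour.
  leafIn : (r : Fin n) → let open Rooted (rooted T conn r) in
           {D : Fin n → Set} → (∀ v → Dec (D v)) → (∀ v → D v → v ≢ r) →
           (∀ {w} → w ≢ r → D (par w) → D w) → ∃ D → ∃[ x ] (D x × degree T x ≡ 1)
  leafIn r {D} D? D⇒≢r closed nonempty with argmax D? (Rooted.ρ (rooted T conn r)) nonempty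
  ... | x , dx , max = x , dx , ≤-antisym (singleNeighbour⇒degree≤1 T (par x) only)
                                          (neighbour⇒1≤degree T (par-adj x (D⇒≢r x dx)))
    where
    open RootedProperties (rooted T conn r)
    only : ∀ w → Adjacent T x w → w ≡ par x
    only w xw with tree r x w xw
    ... | inj₁ (_ , e)      = ≡.sym e
    ... | inj₂ (w≢r , refl) = contradiction (max w (closed w≢r dx)) (<⇒≱ (par-< w w≢r))

  -- Take any end `u` and a branch vertex `b` farthest from it: paths to `u` from the other branch
  -- vertices never get as deep as `b` after their start.
  outermostBranch : ∃[ b ] 3 ≤ degree T b → ∃[ u ] ∃[ b ] (degree T u ≡ 1 × 3 ≤ degree T b × Outermost T u b)
  outermostBranch (b₀ , b₀-branch) with leafIn b₀ (λ v → ¬? (v ≟ᶠ b₀)) (λ _ ne → ne) (λ ne _ → ne) nonempty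
    where
    nonempty : ∃[ v ] v ≢ b₀
    nonempty with secondNeighbour T b₀ (<⇒≤ b₀-branch)
    ... | w , _ , w≢b₀ = w , w≢b₀
  ... | u , _ , u-leaf with argmax (λ v → 3 ≤? degree T v) (Rooted.ρ (rooted T conn u)) (b₀ , b₀-branch)
  ...   | b , b-branch , max = u , b , u-leaf , b-branch , λ z z-branch z≢b →
    reverse (avoiding-sym T) (rootPath-avoids T (rooted T conn u) z≢b (max z z-branch))

  -- Take an end `x` strictly beyond `b` as seen from `u`. A branch vertex `z` nearer to `x` than
  -- `b` would give a walk from `x` through `z` to `u` avoiding `b`, but the only way out of the
  -- subtree at `b` is through `b`.
  outermostLeg : ∀ {u b} → degree T u ≡ 1 → 3 ≤ degree T b → Outermost T u b →
                 ∃[ x ] (degree T x ≡ 1 × x ≢ u ×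
                         (let open Rooted (rooted T conn x) in ∀ z → 3 ≤ degree T z → ρ b ≤ ρ z))
  outermostLeg {u} {b} u-leaf b-branch outer
    with leafIn u (λ v → anc? b v ×-dec ¬? (v ≟ᶠ b)) beyond⇒≢u closed nonempty
    where
    open RootedProperties (rooted T conn u)
    Beyond : Fin n → Set
    Beyond v = Anc b v × v ≢ b
    b≢u : b ≢ u
    b≢u = leaf≢branch T u-leaf b-branch ∘ ≡.sym
    beyond⇒≢u : ∀ v → Beyond v → v ≢ u
    beyond⇒≢u v (p , _) refl = ¬Anc-root b≢u p
    closed : ∀ {w} → w ≢ u → Beyond (par w) → Beyond w
    closed {w} w≢u (p , _) = up w≢u p , λ { refl → <⇒≱ (par-< b b≢u) (Anc⇒≤ p) }
    nonempty : ∃ Beyond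
    nonempty with secondNeighbour T (par b) (<⇒≤ b-branch)
    ... | c , bc , c≢par with tree u b c bc
    ...   | inj₁ (_ , e)      = contradiction (≡.sym e) c≢par
    ...   | inj₂ (c≢u , refl) = c , up c≢u base , Adj⇒≢ T bc ∘ ≡.sym
  ... | x , x-beyond , x-leaf = x , x-leaf , (λ { refl → ¬Anc-root b≢u (proj₁ x-beyond) }) , nearest
    where
    open RootedProperties (rooted T conn u)
    b≢u : b ≢ u
    b≢u = leaf≢branch T u-leaf b-branch ∘ ≡.sym
    stays : ∀ {v w} → Anc b v → v ≢ b → Star (Avoiding T b) v w → Anc b w
    stays p v≢b ε = p
    stays {v} p v≢b (_◅_ {j = w} (vw , _ , w≢b) walk) with tree u v w vw
    ... | inj₂ (w≢u , refl) = stays (up w≢u p) w≢b walk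
    ... | inj₁ (_ , refl) with p
    ...   | base   = contradiction refl v≢b
    ...   | up _ q = stays q w≢b walk
    ρₓ = Rooted.ρ (rooted T conn x)
    nearest : ∀ z → 3 ≤ degree T z → ρₓ b ≤ ρₓ z
    nearest z z-branch with z ≟ᶠ b | ρₓ b ≤? ρₓ z
    ... | yes refl | _      = ≤-refl
    ... | no _     | yes le = le
    ... | no z≢b   | no ¬le = ⊥-elim (¬Anc-root b≢u (stays (proj₁ x-beyond) (proj₂ x-beyond)
      (reverse (avoiding-sym T) (outer z z-branch z≢b
        ◅◅ rootPath-avoids T (rooted T conn x) z≢b (<⇒≤ (≰⇒> ¬le))))))

-- Degree counting

numDegree2 : Graph n → ℕ
numDegree2 T = sum (λ v → ⟦ does (degree T v ≟ 2) ⟧)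

cost+numDegree2≤n : (T : Graph n) → cost T + numDegree2 T ≤ n
cost+numDegree2≤n {n} T = begin
  cost T + numDegree2 T                                         ≡⟨ ∑-distrib-+ (φ ∘ degree T) _ ⟨
  sum (λ v → φ (degree T v) + ⟦ does (degree T v ≟ 2) ⟧)        ≤⟨ sum-mono-≤ (pointwise ∘ degree T) ⟩
  sum {n} (λ _ → 1)                                             ≡⟨ sum-one n ⟩
  n                                                             ∎
  where
  pointwise : ∀ d → φ d + ⟦ does (d ≟ 2) ⟧ ≤ 1
  pointwise 0 = z≤n
  pointwise 1 = ≤-refl
  pointwise 2 = ≤-refl
  pointwise (suc (suc (suc d))) = ≤-refl

degree-classes : ∀ d → 1 ≤ d → d ≡ 1 ⊎ d ≡ 2 ⊎ 3 ≤ d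
degree-classes 1 _ = inj₁ refl
degree-classes 2 _ = inj₂ (inj₁ refl)
degree-classes (suc (suc (suc d))) _ = inj₂ (inj₂ (s≤s (s≤s (s≤s z≤n))))

-- The four conditions say that no improving exchange is available for `u` and `x`; the degree sum
-- is then bounded by counting vertex by vertex.
module _ (G T : Graph n) (conn : Conn T) {u x b : Fin n} (u-leaf : degree T u ≡ 1)
         (small : ∀ w → Adjacent G u w → ¬ Adjacent T u w → ¬ 3 ≤ degree T (Rooted.par (rooted T conn u) w))
         (noLeaf : ∀ y → Adjacent G x y → degree T y ≢ 1)
         (noBranch : ∀ y → Adjacent G x y → 3 ≤ degree T y → y ≡ b)
         (disjoint : ∀ w → Adjacent G u w → ¬ Adjacent T u w →
                     degree T (Rooted.par (rooted T conn u) w) ≡ 2 → ¬ Adjacent G x (Rooted.par (rooted T conn u) w))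
         where
  private
    open RootedProperties (rooted T conn u)

    shifted : Fin n → Fin n → Bool
    shifted s w = adj G u w ∧ does (par w ≟ᶠ s)

    shifted⇒ : ∀ {s w} → shifted s w ≡ true → Adjacent G u w × par w ≡ s
    shifted⇒ {s} {w} e with adj G u w
    ... | true = refl , does-true (par w ≟ᶠ s) e

    -- The size of the fibre over `s` of the map `par` on the `G`-neighbours of `u`. Double counting
    -- gives the degree of `u`; injectivity makes each fibre at most 1.
    N′ : Fin n → ℕ
    N′ s = sum (λ w → ⟦ shifted s w ⟧)

    sum-N′ : sum N′ ≡ degree G u
    sum-N′ = begin-equality
      sum (λ s → sum (λ w → ⟦ shifted s w ⟧))     ≡⟨ ∑-comm (λ s w → ⟦ shifted s w ⟧) ⟩
      sum (λ w → sum (λ s → ⟦ shifted s w ⟧))     ≡⟨ sum-cong-≗ inner ⟩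
      sum (λ w → ⟦ adj G u w ⟧)                   ≡⟨ degree≡sum G u ⟨
      degree G u                                  ∎
      where
      inner : ∀ w → sum (λ s → ⟦ shifted s w ⟧) ≡ ⟦ adj G u w ⟧
      inner w with adj G u w
      ... | true  = sum-δ′ (par w)
      ... | false = sum-replicate-zero n

    module _ {w : Fin n} (uw : Adjacent G u w) where
      w≢u : w ≢ u
      w≢u = Adj⇒≢ G uw ∘ ≡.sym

      parent≢u⇒¬adj : par w ≢ u → ¬ Adjacent T u w
      parent≢u⇒¬adj ne Tuw = ne (ρ≡0 _ (n≤0⇒n≡0 (≤-pred (≤-trans (par-< w w≢u)
        (≤-trans (ρ-lip Tuw) (≤-reflexive (cong suc ρ-root)))))))

      parent-degree2 : par w ≢ u → degree T (par w) ≡ 2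
      parent-degree2 ne = ≤-antisym (≤-pred (≰⇒> (small w uw (parent≢u⇒¬adj ne))))
        (child⇒2≤degree ne (par-adj′ w w≢u) (par-< w w≢u))

    -- Two children of `s` contradict `u` being an end if `s` is `u`; otherwise, with the parent of
    -- `s`, they contradict `s` having degree 2.
    shifted-unique : ∀ s w w′ → shifted s w ≡ true → shifted s w′ ≡ true → w ≡ w′
    shifted-unique s w w′ e e′ with w ≟ᶠ w′
    ... | yes eq = eq
    ... | no w≢w′ with shifted⇒ e | shifted⇒ e′
    ...   | uw , refl | uw′ , eq = ⊥-elim absurd
      where
      sw : Adjacent T s w
      sw = par-adj′ w (w≢u uw)
      sw′ : Adjacent T s w′
      sw′ = subst (λ q → Adjacent T q w′) eq (par-adj′ w′ (w≢u uw′))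
      absurd : ⊥
      absurd with s ≟ᶠ u
      ... | yes s≡u = <⇒≱ (neighbours⇒2≤degree T w≢w′ sw sw′) (≤-reflexive (trans (cong (degree T) s≡u) u-leaf))
      ... | no s≢u  = <⇒≱
        (neighbours⇒3≤degree T w≢w′ (notParent (w≢u uw) refl) (notParent (w≢u uw′) eq) sw sw′ (par-adj s s≢u))
        (≤-reflexive (parent-degree2 uw s≢u))
        where
        notParent : ∀ {v} → v ≢ u → par v ≡ s → v ≢ par s
        notParent {v} v≢u par≡s refl = <-asym (par-< s s≢u) (subst (λ q → ρ q < ρ v) par≡s (par-< v v≢u))

    shifted⇒class : ∀ {s w} → shifted s w ≡ true → s ≡ u ⊎ degree T s ≡ 2
    shifted⇒class {s} e with shifted⇒ e | s ≟ᶠ u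
    ... | uw , refl | yes s≡u = inj₁ s≡u
    ... | uw , refl | no s≢u  = inj₂ (parent-degree2 uw s≢u)

    bound : Fin n → ℕ
    bound s = ⟦ does (degree T s ≟ 2) ⟧ + (δ s u + δ s b)

    class⇒1≤bound : ∀ {s} → degree T s ≡ 2 ⊎ s ≡ u ⊎ s ≡ b → 1 ≤ bound s
    class⇒1≤bound {s} (inj₁ e) = ≤-trans (≤-reflexive (≡.sym (⟦yes⟧ (degree T s ≟ 2) e))) (m≤m+n _ _)
    class⇒1≤bound {s} (inj₂ (inj₁ e)) =
      ≤-trans (≤-reflexive (≡.sym (⟦yes⟧ (s ≟ᶠ u) e))) (≤-trans (m≤m+n _ (δ s b)) (m≤n+m _ ⟦ does (degree T s ≟ 2) ⟧))
    class⇒1≤bound {s} (inj₂ (inj₂ e)) =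
      ≤-trans (≤-reflexive (≡.sym (⟦yes⟧ (s ≟ᶠ b) e))) (≤-trans (m≤n+m _ (δ s u)) (m≤n+m _ ⟦ does (degree T s ≟ 2) ⟧))

    -- The fibre over a neighbour of `x` is empty and any other fibre has at most one element, so
    -- the left side is at most 1; where it is 1, `s` has degree 2 or is `u` or `b`.
    pointwise : ∀ s → N′ s + ⟦ adj G x s ⟧ ≤ bound s
    pointwise s with adj G x s in xs
    ... | true = ≤-trans (≤-reflexive (cong (_+ 1) (sum-zero empty))) (class⇒1≤bound class)
      where
      s≢u : s ≢ u
      s≢u refl = noLeaf s xs u-leaf
      empty : ∀ w → ⟦ shifted s w ⟧ ≡ 0
      empty w = cong ⟦_⟧ (B.¬-not λ e → case shifted⇒ e of λ where
        (uw , refl) → disjoint w uw (parent≢u⇒¬adj uw s≢u) (parent-degree2 uw s≢u) xs)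
      class : degree T s ≡ 2 ⊎ s ≡ u ⊎ s ≡ b
      class with degree-classes (degree T s) (neighbour⇒1≤degree T (par-adj s s≢u))
      ... | inj₁ e        = contradiction e (noLeaf s xs)
      ... | inj₂ (inj₁ e) = inj₁ e
      ... | inj₂ (inj₂ e) = inj₂ (inj₂ (noBranch s xs e))
    ... | false with any? (λ w → shifted s w B.≟ true)
    ...   | no none = ≤-trans (≤-reflexive (trans (+-identityʳ _)
                        (sum-zero λ w → cong ⟦_⟧ (B.¬-not λ e → none (w , e))))) z≤n
    ...   | yes (w , e) = ≤-trans (≤-trans (≤-reflexive (+-identityʳ (N′ s))) (sum≤1 (shifted-unique s)))
                            (class⇒1≤bound (case shifted⇒class {s} {w} e of λ where
                              (inj₁ s≡u) → inj₂ (inj₁ s≡u)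
                              (inj₂ s-2) → inj₁ s-2))

  degree-sum-bound : degree G u + degree G x ≤ numDegree2 T + 2
  degree-sum-bound = begin
    degree G u + degree G x                       ≡⟨ cong₂ _+_ (≡.sym sum-N′) (degree≡sum G x) ⟩
    sum N′ + sum (λ s → ⟦ adj G x s ⟧)            ≡⟨ ∑-distrib-+ N′ _ ⟨
    sum (λ s → N′ s + ⟦ adj G x s ⟧)              ≤⟨ sum-mono-≤ pointwise ⟩
    sum bound                                     ≡⟨ sum-+2δ (λ s → ⟦ does (degree T s ≟ 2) ⟧) u b ⟩
    numDegree2 T + 2                              ∎

-- Descent to a spanning tree of small cost.

module Descent (G : Graph n) (k : ℕ) (1≤k : 1 ≤ k)
               (ore : ∀ u v → u ≢ v → ¬ Adjacent G u v → suc n ≤ degree G u + degree G v + k) where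

  Good : Set
  Good = ∃[ T ] (IsSpanningTree T G × cost T ≤ suc k)

  good : (T : Graph n) (conn : Conn T) → Tree T conn → Subgraph T G → cost T ≤ suc k → Good
  good T conn tree T⊆G bound =
    T , (T⊆G , (λ u v → star⇒walk (conn u v)) , tree⇒acyclic T conn tree) , bound

  cost-from-degrees : (T : Graph n) {u x : Fin n} → u ≢ x → ¬ Adjacent G u x →
                      degree G u + degree G x ≤ numDegree2 T + 2 → cost T ≤ suc k
  cost-from-degrees T {u} {x} u≢x ¬ux le = +-cancelʳ-≤ (numDegree2 T) _ _ (≤-pred (begin
    suc (cost T + numDegree2 T)             ≤⟨ s≤s (cost+numDegree2≤n T) ⟩
    suc n                                   ≤⟨ ore u x u≢x ¬ux ⟩
    degree G u + degree G x + k             ≤⟨ +-monoˡ-≤ k le ⟩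
    numDegree2 T + 2 + k                    ≡⟨ +-assoc (numDegree2 T) 2 k ⟩
    numDegree2 T + (2 + k)                  ≡⟨ +-comm (numDegree2 T) (2 + k) ⟩
    suc (suc k + numDegree2 T)              ∎))

  -- `smaller` and `cheaper` are the induction hypotheses of a lexicographic descent on size and
  -- cost.
  module _ (e f : ℕ)
           (smaller : ∀ T → Conn T → Subgraph T G → size T < e → Good)
           (cheaper : ∀ T → Conn T → Subgraph T G → size T ≡ e → cost T < f → Good) where

    dropEdge : ∀ T → Subgraph T G → size T ≡ e → ∀ {v w} → Adjacent T v w → Conn (remove T v w) → Good
    dropEdge T T⊆G sz {v} {w} vw conn′ = smaller (remove T v w) conn′
      (λ v′ w′ a → T⊆G v′ w′ (remove-⊆ T {v} {w} v′ w′ a)) (<-≤-trans (size-remove T vw) (≤-reflexive sz))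

    -- Every round cuts one leg off b, so b runs out of legs after at most d rounds.
    drain : ∀ d T → Conn T → Subgraph T G → size T ≡ e → cost T ≤ f → ∀ {u b} →
            degree T u ≡ 1 → 3 ≤ degree T b → degree T b ≤ d → Outermost T u b → Good
    drain zero    T conn T⊆G sz ct u-leaf b-branch ≤d outer with () ← ≤-trans b-branch ≤d
    drain (suc d) T conn T⊆G sz ct {u} {b} u-leaf b-branch ≤d outer with tree-or-redundantEdge T conn
    ... | inj₂ (v , w , vw , conn′) = dropEdge T T⊆G sz vw conn′
    ... | inj₁ tree with outermostLeg T conn tree u-leaf b-branch outer
    ...   | x , x-leaf , x≢u , nearest = result
      where
      open Rooted (rooted T conn u)

      better⇒good : Better G T → Good
      better⇒good (T′ , conn′ , T′⊆G , sz′ , lt) = cheaper T′ conn′ T′⊆G (trans sz′ sz) (<-≤-trans lt ct)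

      moveLeg : ∀ y → Adjacent G x y → 3 ≤ degree T y → y ≢ b → Good
      moveLeg y xy y-branch y≢b with degree T b ≟ 3
      -- `b` falls to degree 2, which saves one, and the branch vertex `y` cannot become dearer.
      ... | yes b-3 = better⇒good (T′ , connected , subgraph , sameSize ,
              ≤-trans (≤-reflexive (+-comm 1 (cost T′))) (cost-exchange 0 1 gain-y gain-b))
        where
        open LegSwap G T conn T⊆G x-leaf b-branch nearest (Adj⇒≢ G xy) y≢b (branch⇒≢2 y-branch) xy
        gain-y : φ (degree T y + 1) + 0 ≤ φ (degree T y)
        gain-y rewrite φ-branch y-branch | +-identityʳ (φ (degree T y + 1)) = φ≤1 (degree T y + 1)
        gain-b : ∀ d → d + 1 ≡ degree T b → φ d + 1 ≤ φ (degree T b)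
        gain-b d eq rewrite b-3 | +-cancelʳ-≡ 1 d 2 eq = ≤-refl
      -- `b` is still a branch vertex, with one neighbour fewer, and the cost has not risen: another
      -- round with the same `u` and `b`.
      ... | no b≢3 = drain d T′ connected subgraph (trans sameSize sz)
                           (≤-trans (≤-trans (≤-reflexive (≡.sym (+-identityʳ (cost T′)))) (cost-exchange 0 0 gain-y gain-b)) ct)
                           u-leaf′ (≤-pred (≤-trans (≤∧≢⇒< b-branch (b≢3 ∘ ≡.sym)) (≤-reflexive (≡.sym branch-degree))))
                           (≤-pred (≤-trans (≤-reflexive branch-degree) ≤d)) outer′
        where
        open LegSwap G T conn T⊆G x-leaf b-branch nearest (Adj⇒≢ G xy) y≢b (branch⇒≢2 y-branch) xy
        gain-y : φ (degree T y + 1) + 0 ≤ φ (degree T y)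
        gain-y rewrite φ-branch y-branch | +-identityʳ (φ (degree T y + 1)) = φ≤1 (degree T y + 1)
        gain-b : ∀ d → d + 1 ≡ degree T b → φ d + 0 ≤ φ (degree T b)
        gain-b d _ rewrite φ-branch b-branch | +-identityʳ (φ d) = φ≤1 d
        u-leaf′ : degree T′ u ≡ 1
        u-leaf′ = trans (unchanged-degree (x≢u ∘ ≡.sym) (leaf≢branch T u-leaf y-branch)
          (leaf≢branch T u-leaf b-branch) (leaf≢b′ u-leaf (x≢u ∘ ≡.sym))) u-leaf
        outer′ : Outermost T′ u b
        -- By `branch-reflect` no branch vertex is new, and the deleted edge meets `b`, so the old
        -- walks still serve.
        outer′ z z-branch z≢b = Star.map (λ (vw , v≢b , w≢b) → swap-keeps T {x≢y = Adj⇒≢ G xy} vw (λ where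
            (inj₁ (v≡b , _)) → v≢b v≡b
            (inj₂ (_ , w≡b)) → w≢b w≡b) , v≢b , w≢b)
          (outer z (branch-reflect y-branch z z-branch) z≢b)

      result : Good
      -- Each search that succeeds leads to progress; the failure of all four supplies the
      -- hypotheses of `degree-sum-bound`.
      result with any? (λ w → adj? G u w ×-dec ¬? (adj? T u w) ×-dec (3 ≤? degree T (par w)))
                | any? (λ y → adj? G x y ×-dec (degree T y ≟ 1))
                | any? (λ y → adj? G x y ×-dec (3 ≤? degree T y) ×-dec ¬? (y ≟ᶠ b))
                | any? (λ w → adj? G u w ×-dec ¬? (adj? T u w) ×-dec (degree T (par w) ≟ 2) ×-dec adj? G x (par w))
      ... | yes (w , uw , ¬uw , big) | _ | _ | _ =
        better⇒good (Slide.branch⇒better G T conn T⊆G u-leaf uw ¬uw big)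
      ... | no _ | yes (y , xy , y-leaf) | _ | _ =
        better⇒good (adjacentLeaves⇒better G T conn T⊆G x-leaf y-leaf xy (b , b-branch))
      ... | no _ | no _ | yes (y , xy , y-branch , y≢b) | _ = moveLeg y xy y-branch y≢b
      ... | no _ | no _ | no _ | yes (w , uw , ¬uw , s-2 , xs) =
        better⇒good (Slide.adjacent⇒better G T conn T⊆G u-leaf uw ¬uw s-2 x-leaf x≢u xs b-branch)
      ... | no none₁ | no none₂ | no none₃ | no none₄ = good T conn tree T⊆G
        -- An edge `ux` of `G` would have been found by the second search, `u` being an end; so the
        -- degree condition applies to this pair.
        (cost-from-degrees T (x≢u ∘ ≡.sym) (λ ux → none₂ (u , Adj-sym G ux , u-leaf))
          (degree-sum-bound G T conn {b = b} u-leaf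
            (λ w uw ¬uw big → none₁ (w , uw , ¬uw , big))
            (λ y xy y-leaf → none₂ (y , xy , y-leaf))
            noBranch
            (λ w uw ¬uw s-2 xs → none₄ (w , uw , ¬uw , s-2 , xs))))
        where
        noBranch : ∀ y → Adjacent G x y → 3 ≤ degree T y → y ≡ b
        noBranch y xy y-branch with y ≟ᶠ b
        ... | yes eq = eq
        ... | no ne  = contradiction (y , xy , y-branch , ne) none₃

    improve : ∀ T → Conn T → Subgraph T G → size T ≡ e → cost T ≤ f → Good
    improve T conn T⊆G sz ct with tree-or-redundantEdge T conn
    ... | inj₂ (v , w , vw , conn′) = dropEdge T T⊆G sz vw conn′
    ... | inj₁ tree with any? (λ b → 3 ≤? degree T b)
    -- 2 is at most `k + 1` because `k` is positive.
    ...   | no none = good T conn tree T⊆G (≤-trans (noBranch⇒cost≤2 T conn none) (s≤s 1≤k))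
    ...   | yes branch with outermostBranch T conn tree branch
    ...     | u , b , u-leaf , b-branch , outer = drain (degree T b) T conn T⊆G sz ct u-leaf b-branch ≤-refl outer

  -- `e` and `f` are strict bounds on size and cost. Deleting an edge may raise the cost, so the
  -- cost bound is then reset while the size bound falls.
  descend : ∀ e f T → Conn T → Subgraph T G → size T < e → cost T < f → Good
  descend (suc e) (suc f) T conn T⊆G (s≤s sz) (s≤s ct) = improve (size T) (cost T)
    (λ T′ conn′ T′⊆G lt → descend e (suc (cost T′)) T′ conn′ T′⊆G (<-≤-trans lt sz) ≤-refl)
    (λ T′ conn′ T′⊆G eq lt → descend (suc e) f T′ conn′ T′⊆G (s≤s (≤-trans (≤-reflexive eq) sz)) (<-≤-trans lt ct))
    T conn T⊆G refl ≤-refl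

-- Translation between integer and natural-number bounds.

open import Data.Integer using (+_; _-_; _⊖_) renaming (_+_ to _+ℤ_; _≤_ to _≤ℤ_)
import Data.Integer.Properties as ℤ

private
  sub+1≡⊖ : ∀ a b → (+ a - + b) +ℤ + 1 ≡ suc a ⊖ b
  sub+1≡⊖ a b = trans (cong (_+ℤ + 1) (ℤ.m-n≡m⊖n a b))
    (trans (ℤ.distribˡ-⊖-+-pos 1 a b) (cong (_⊖ b) (+-comm a 1)))

  m+n⊖n≡m : ∀ a b → a + b ⊖ b ≡ + a
  m+n⊖n≡m a b = trans (cong₂ _⊖_ (+-comm a b) (≡.sym (+-identityʳ b))) (ℤ.+-cancelˡ-⊖ b a 0)

  sub+1≤⇒≤+ : ∀ a b m → (+ a - + b) +ℤ + 1 ≤ℤ + m → suc a ≤ m + b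
  sub+1≤⇒≤+ a b m le = ℤ.drop‿+≤+ (subst (_≤ℤ + (m + b))
    (trans (cong (_+ℤ + b) (sub+1≡⊖ a b)) (trans (ℤ.distribˡ-⊖-+-pos b (suc a) b) (m+n⊖n≡m (suc a) b)))
    (ℤ.+-monoˡ-≤ (+ b) le))

  +≤⇒≤sub+1 : ∀ a b m → a + b ≤ suc m → + a ≤ℤ (+ m - + b) +ℤ + 1
  +≤⇒≤sub+1 a b m le = subst (+ a ≤ℤ_) (≡.sym (sub+1≡⊖ m b))
    (subst (_≤ℤ suc m ⊖ b) (m+n⊖n≡m a b) (ℤ.⊖-monoˡ-≤ b le))

theorem1 : (n : ℕ) → 1 ≤ n → (G : Graph n) → Connected G →
    (k : ℕ) → 1 ≤ k → σ₂≥ G ((+ n - + k) +ℤ + 1) →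
    ∃[ T ] (IsSpanningTree T G ×
    (+ numEnd T) ≤ℤ ((+ k - + numBranch T) +ℤ + 1))
theorem1 n _ G connected k 1≤k σ₂ =
  -- The descent starts from `G`, a connected spanning subgraph of itself.
  case descend (suc (size G)) (suc (cost G)) G (λ u v → walk⇒star (proj₂ (connected u v))) (λ _ _ uv → uv)
               ≤-refl ≤-refl of λ where
    (T , spanning , bound) → T , spanning ,
      +≤⇒≤sub+1 (numEnd T) (numBranch T) k (≤-trans (≤-reflexive (≡.sym (cost≡ T))) bound)
  where
  open Descent G k 1≤k (λ u v u≢v ¬uv → sub+1≤⇒≤+ n k _ (σ₂ u v u≢v ¬uv))
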